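{- Let $j\ge 2$ be an integer and let $G$ be a connected graph with non-empty bridge set $B(G)$. If there is no bridge $b\in B(G)$ such that $G-\{b\}$ has a component that is bipartite or isomorphic to $K_1$, then $\zeta_{2j}(G)\le 3+|B(G)|$. Otherwise (i.e. if for some bridge $b$ the graph $G-\{b\}$ has a component that is bipartite or isomorphic to $K_1$), there is no finite non-trivial abelian group $\mathbb{A}$ such that $G$ is zero-sum $\mathbb{A}$-magic.
   Context: Graphs are finite and loopless, but may have multiple edges. A bridge is an edge whose deletion results in a graph with exactly one more component than $G$; $B(G)$ is the set of bridges of $G$. For a non-trivial abelian group $\mathbb{A}$ (written additively, identity $0$), a graph $G$ is zero-sum $\mathbb{A}$-magic if there is a function $\phi: E(G)\to \mathbb{A}\setminus\{0\}$ such that for every vertex $v$ the sum of $\phi(e)$ over all edges $e$ incident to $v$ is $0$. $\mathbb{Z}_n$ is the group of integers modulo $n$, and $\mathbb{Z}_n^k$ is the direct product of $k$ copies of it. For $j\ge 1$, $\zeta_{2j}(G)$ is the smallest positive integer $c$ such that $G$ is zero-sum $\mathbb{Z}_{2j}^c$-magic if such $c$ exists, and $\infty$ otherwise. -}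

module Defs where

open import Algebra.Bundles using (AbelianGroup)
import Algebra.Construct.Pointwise as Pointwise
import Algebra.Properties.CommutativeMonoid.Sum as Sum
open import Data.Bool.Base using (Bool; if_then_else_)
open import Data.Fin.Base using (Fin; zero; suc; punchIn; punchOut)
open import Data.Fin.Properties
  using (_≟_; punchInᵢ≢i; punchIn-punchOut; punchOut-punchIn; punchOut-cong)
open import Data.Fin.Subset using (Subset)
open import Data.Integer.Base as ℤ using (ℤ; +_; 0ℤ)
import Data.Integer.Divisibility.Signed as ℤ
import Data.Integer.Properties as ℤ
open import Data.Integer.Tactic.RingSolver using (solve-∀)
open import Data.List.Base using (List; length; lookup; filter; allFin)
open import Data.List.Membership.Propositional using (_∈_)
open import Data.List.Membership.Propositional.Properties
  using (∈-allFin; ∈-filter⁺; ∈-filter⁻; ∈-lookup)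
open import Data.List.Relation.Unary.Any using (index)
open import Data.List.Relation.Unary.Any.Properties using (lookup-index)
open import Data.Nat.Base using (ℕ; zero; suc; _≤_)
import Data.Nat.Properties as ℕ
open import Data.Product.Base using (_×_; _,_; proj₁; proj₂; ∃-syntax; Σ-syntax; map; swap)
open import Data.Sum.Base using (_⊎_; inj₁; inj₂)
open import Data.Vec.Base using (tabulate)
open import Function.Base using (_∘_; id)
open import Function.Bundles using (Inverse; _↔_)
open import Level using (0ℓ; _⊔_)
open import Relation.Binary.Bundles using (Setoid)
import Relation.Binary.Construct.Closure.Equivalence as EqC
open import Relation.Binary.PropositionalEquality
  using (_≡_; _≢_; refl; sym; trans; cong; subst; isEquivalence; setoid; ≢-sym)
open import Relation.Nullary.Construct.Add.Supremum using (_⁺; ⊤⁺; [_])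
open import Relation.Nullary.Decidable using (Dec; yes; no; does; _⊎-dec_)
open import Relation.Nullary.Negation using (¬_; contradiction)

HasCardinality : ∀ {a ℓ} → Setoid a ℓ → ℕ → Set (a ⊔ ℓ)
HasCardinality S n = Inverse S (setoid (Fin n))

------------------------------------------------------------------------
-- Graphs

-- The order of the two ends of an edge carries no meaning: every notion
-- below is symmetric in them.  Parallel edges are allowed.
record Graph : Set where
  field
    order : ℕ
    size  : ℕ

  Vertex : Set
  Vertex = Fin order

  Edge : Set
  Edge = Fin size

  field
    ends     : Edge → Vertex × Vertex
    loopless : ∀ e → proj₁ (ends e) ≢ proj₂ (ends e)

  Incident : Vertex → Edge → Set
  Incident v e = v ≡ proj₁ (ends e) ⊎ v ≡ proj₂ (ends e)

  incident? : ∀ v e → Dec (Incident v e)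
  incident? v e = (v ≟ proj₁ (ends e)) ⊎-dec (v ≟ proj₂ (ends e))

K₁ : Graph
K₁ = record { order = 1 ; size = 0 ; ends = λ () ; loopless = λ () }

record _≅_ (G H : Graph) : Set where
  private
    module G = Graph G
    module H = Graph H
  field
    vertices : G.Vertex ↔ H.Vertex
    edges    : G.Edge ↔ H.Edge

  private
    f = Inverse.to vertices
    g = Inverse.to edges

  field
    ends-preserved : ∀ e →
      H.ends (g e) ≡ map f f (G.ends e) ⊎ H.ends (g e) ≡ swap (map f f (G.ends e))

Bipartite : Graph → Set
Bipartite G = Σ[ side ∈ (Vertex → Bool) ] (∀ e → side (proj₁ (ends e)) ≢ side (proj₂ (ends e)))
  where open Graph G

_-ₑ_ : (G : Graph) → Graph.Edge G → Graph
record { order = n ; size = suc m ; ends = ends ; loopless = loopless } -ₑ e = record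
  { order    = n
  ; size     = m
  ; ends     = ends ∘ punchIn e
  ; loopless = loopless ∘ punchIn e
  }

------------------------------------------------------------------------
-- Connectivity

module _ {n m : ℕ} (ends : Fin m → Fin n × Fin n) where

  Link : Fin n → Fin n → Set
  Link u v = ∃[ e ] ends e ≡ (u , v)

  -- The equivalence closure of `Link` relates u and v exactly when a walk
  -- (traversing edges in either direction) joins them.
  walkSetoid : Setoid 0ℓ 0ℓ
  walkSetoid = EqC.setoid Link

-- The components, i.e. the classes of vertices under `walkSetoid`, are finite
-- in number: add the edges one at a time, merging two labels when necessary.
components : ∀ {n m} (ends : Fin m → Fin n × Fin n) →
             ∃[ k ] HasCardinality (walkSetoid ends) k
components {n} {m} ends = count m ends
  where
  labelling : ∀ {m k} (ends : Fin m → Fin n × Fin n)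
              (let open Setoid (walkSetoid ends) using (_≈_))
              (to : Fin n → Fin k) (from : Fin k → Fin n) →
              (∀ e → to (proj₁ (ends e)) ≡ to (proj₂ (ends e))) →
              (∀ i → to (from i) ≡ i) →
              (∀ v → from (to v) ≈ v) →
              HasCardinality (walkSetoid ends) k
  labelling ends to from to-ends to∘from from∘to = record
    { to        = to
    ; from      = from
    ; to-cong   = to-cong
    ; from-cong = λ { refl → Setoid.refl (walkSetoid ends) }
    ; inverse   = (λ y≈ → trans (to-cong y≈) (to∘from _))
                , (λ { refl → from∘to _ })
    }
    where
    open Setoid (walkSetoid ends) using (_≈_)

    to-cong : ∀ {u v} → u ≈ v → to u ≡ to v
    to-cong = EqC.gfold isEquivalence to λ { (e , eq) →
      trans (cong to (sym (cong proj₁ eq))) (trans (to-ends e) (cong to (cong proj₂ eq))) }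

  count : ∀ m (ends : Fin m → Fin n × Fin n) → ∃[ k ] HasCardinality (walkSetoid ends) k
  count zero    ends =
    n , labelling ends id id (λ ()) (λ _ → refl) (λ _ → Setoid.refl (walkSetoid ends))
  count (suc m) ends with count m (ends ∘ suc)
  ... | k , I = case k I (Inverse.to I u ≟ Inverse.to I v)
    where
    u = proj₁ (ends zero)
    v = proj₂ (ends zero)

    open Setoid (walkSetoid ends) using (_≈_) renaming (refl to ≈-refl; trans to ≈-trans)

    weaken : ∀ {x y} → Setoid._≈_ (walkSetoid (ends ∘ suc)) x y → x ≈ y
    weaken = EqC.map λ { (e , eq) → suc e , eq }

    case : ∀ k (I : HasCardinality (walkSetoid (ends ∘ suc)) k) →
           Dec (Inverse.to I u ≡ Inverse.to I v) →
           ∃[ k′ ] HasCardinality (walkSetoid ends) k′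
    case k I (yes p) = k , labelling ends to from
        (λ { zero → p ; (suc e) → to-cong (EqC.return (e , refl)) })
        strictlyInverseˡ
        (weaken ∘ strictlyInverseʳ)
      where open Inverse I
    case zero I (no a≢b) with () ← Inverse.to I u
    case (suc k) I (no a≢b) = k , labelling ends (merge ∘ to) (from ∘ punchIn b)
        (λ { zero    → trans (merge-≢ (≢-sym a≢b)) (sym (merge-≡ refl))
           ; (suc e) → cong merge (to-cong (EqC.return (e , refl))) })
        (λ i → trans (cong merge (strictlyInverseˡ (punchIn b i)))
              (trans (merge-≢ (≢-sym (punchInᵢ≢i b i))) (punchOut-punchIn b)))
        back
      where
      open Inverse I
      a = to u
      b = to v

      merge : Fin (suc k) → Fin k
      merge c with b ≟ c
      ... | yes _  = punchOut (≢-sym a≢b)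
      ... | no b≢c = punchOut b≢c

      merge-≡ : ∀ {c} → b ≡ c → merge c ≡ punchOut (≢-sym a≢b)
      merge-≡ {c} b≡c with b ≟ c
      ... | yes _  = refl
      ... | no b≢c = contradiction b≡c b≢c

      merge-≢ : ∀ {c} (b≢c : b ≢ c) → merge c ≡ punchOut b≢c
      merge-≢ {c} b≢c with b ≟ c
      ... | yes b≡c = contradiction b≡c b≢c
      ... | no _    = punchOut-cong b refl

      back : ∀ w → from (punchIn b (merge (to w))) ≈ w
      back w with b ≟ to w
      ... | no b≢c rewrite punchIn-punchOut b≢c = weaken (strictlyInverseʳ w)
      ... | yes b≡c rewrite punchIn-punchOut (≢-sym a≢b) =
        ≈-trans (weaken (strictlyInverseʳ u))
          (≈-trans (EqC.return (zero , refl)) (weaken (inverseBack b≡c)))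
        where
        inverseBack : b ≡ to w → Setoid._≈_ (walkSetoid (ends ∘ suc)) v w
        inverseBack eq = Setoid.trans (walkSetoid (ends ∘ suc))
          (Setoid.sym (walkSetoid (ends ∘ suc)) (strictlyInverseʳ v))
          (inverseʳ eq)

module _ (G : Graph) where
  open Graph G

  #components : ℕ
  #components = proj₁ (components ends)

  componentOf : Vertex → Fin #components
  componentOf = Inverse.to (proj₂ (components ends))

  Connected : Set
  Connected = #components ≡ 1

  componentOf-ends : ∀ e → componentOf (proj₁ (ends e)) ≡ componentOf (proj₂ (ends e))
  componentOf-ends e =
    Inverse.to-cong (proj₂ (components ends)) (EqC.return (e , refl))

  -- The vertices and edges of the i-th component, renumbered consecutively.
  component : Fin #components → Graph
  component i = record
    { order    = length vs
    ; size     = length es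
    ; ends     = λ k → index (fst∈ k) , index (snd∈ k)
    ; loopless = λ k eq → loopless (lookup es k)
        (trans (lookup-index (fst∈ k)) (trans (cong (lookup vs) eq) (sym (lookup-index (snd∈ k)))))
    }
    where
    vs : List Vertex
    vs = filter (λ v → componentOf v ≟ i) (allFin order)

    es : List Edge
    es = filter (λ e → componentOf (proj₁ (ends e)) ≟ i) (allFin size)

    in-i : ∀ k → componentOf (proj₁ (ends (lookup es k))) ≡ i
    in-i k = proj₂ (∈-filter⁻ (λ e → componentOf (proj₁ (ends e)) ≟ i)
                              {xs = allFin size} (∈-lookup k))

    fst∈ : ∀ k → proj₁ (ends (lookup es k)) ∈ vs
    fst∈ k = ∈-filter⁺ (λ v → componentOf v ≟ i) (∈-allFin _) (in-i k)

    snd∈ : ∀ k → proj₂ (ends (lookup es k)) ∈ vs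
    snd∈ k = ∈-filter⁺ (λ v → componentOf v ≟ i) (∈-allFin _)
               (trans (sym (componentOf-ends (lookup es k))) (in-i k))

module _ (G : Graph) where
  open Graph G

  IsBridge : Edge → Set
  IsBridge e = #components (G -ₑ e) ≡ suc (#components G)

  isBridge? : ∀ e → Dec (IsBridge e)
  isBridge? e = #components (G -ₑ e) ℕ.≟ suc (#components G)

  B : Subset size
  B = tabulate (does ∘ isBridge?)

------------------------------------------------------------------------
-- Groups

module _ {c ℓ} (A : AbelianGroup c ℓ) where
  open AbelianGroup A

  NonTrivial : Set (c ⊔ ℓ)
  NonTrivial = ∃[ x ] ¬ (x ≈ ε)

  Finite : Set (c ⊔ ℓ)
  Finite = ∃[ n ] HasCardinality (AbelianGroup.setoid A) n

-- Integers, with congruence modulo n as the equality.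
ℤ/_ : ℕ → AbelianGroup 0ℓ 0ℓ
ℤ/ n = record
  { Carrier = ℤ
  ; _≈_     = _~_
  ; _∙_     = ℤ._+_
  ; ε       = 0ℤ
  ; _⁻¹     = ℤ.-_
  ; isAbelianGroup = record
    { isGroup = record
      { isMonoid = record
        { isSemigroup = record
          { isMagma = record
            { isEquivalence = record
              { refl  = λ {a} → ≡⇒~ {a} refl
              ; sym   = λ {a} {b} p → subst (+ n ℤ.∣_) (neg-sub a b) (ℤ.∣m⇒∣-m p)
              ; trans = λ {a} {b} {c} p q → subst (+ n ℤ.∣_) (telescope a b c) (ℤ.∣m∣n⇒∣m+n p q)
              }
            ; ∙-cong = λ {a} {b} {c} {d} p q →
                subst (+ n ℤ.∣_) (add-sub a b c d) (ℤ.∣m∣n⇒∣m+n p q)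
            }
          ; assoc = λ a b c → ≡⇒~ (ℤ.+-assoc a b c)
          }
        ; identity = (λ a → ≡⇒~ (ℤ.+-identityˡ a)) , (λ a → ≡⇒~ (ℤ.+-identityʳ a))
        }
      ; inverse = (λ a → ≡⇒~ (ℤ.+-inverseˡ a)) , (λ a → ≡⇒~ (ℤ.+-inverseʳ a))
      ; ⁻¹-cong = λ {a} {b} p → subst (+ n ℤ.∣_) (sub-neg a b) (ℤ.∣m⇒∣-m p)
      }
    ; comm = λ a b → ≡⇒~ (ℤ.+-comm a b)
    }
  }
  where
  _~_ : ℤ → ℤ → Set
  a ~ b = + n ℤ.∣ a ℤ.- b

  ≡⇒~ : ∀ {a b} → a ≡ b → a ~ b
  ≡⇒~ {a} refl = ℤ.divides 0ℤ (ℤ.+-inverseʳ a)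

  neg-sub : ∀ a b → ℤ.- (a ℤ.- b) ≡ b ℤ.- a
  neg-sub = solve-∀

  sub-neg : ∀ a b → ℤ.- (a ℤ.- b) ≡ ℤ.- a ℤ.- ℤ.- b
  sub-neg = solve-∀

  telescope : ∀ a b c → (a ℤ.- b) ℤ.+ (b ℤ.- c) ≡ a ℤ.- c
  telescope = solve-∀

  add-sub : ∀ a b c d → (a ℤ.- b) ℤ.+ (c ℤ.- d) ≡ (a ℤ.+ c) ℤ.- (b ℤ.+ d)
  add-sub = solve-∀

ℤ/_^_ : ℕ → ℕ → AbelianGroup 0ℓ 0ℓ
ℤ/ n ^ k = Pointwise.abelianGroup (Fin k) (ℤ/ n)

------------------------------------------------------------------------
-- Zero-sum magic labellings

module _ {c ℓ} (A : AbelianGroup c ℓ) (G : Graph) where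
  open AbelianGroup A
  open Sum commutativeMonoid using (sum)
  open Graph G

  ZeroSumMagic : Set (c ⊔ ℓ)
  ZeroSumMagic = Σ[ φ ∈ (Edge → Carrier) ]
    (∀ e → ¬ (φ e ≈ ε)) ×
    (∀ v → sum (λ e → if does (incident? v e) then φ e else ε) ≈ ε)

-- ζ n G ≡ z, for z in ℕ ∪ {∞} (with ⊤⁺ as ∞), as the graph of the partial function
-- ζ: computing ζ outright would amount to deciding whether it is infinite.
Isζ : ℕ → Graph → ℕ ⁺ → Set
Isζ n G [ c ] = 1 ≤ c × ZeroSumMagic (ℤ/ n ^ c) G ×
                (∀ c′ → 1 ≤ c′ → ZeroSumMagic (ℤ/ n ^ c′) G → c ≤ c′)
Isζ n G ⊤⁺    = ∀ c → 1 ≤ c → ¬ ZeroSumMagic (ℤ/ n ^ c) G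

{-# OPTIONS --safe #-}
module Submission where

-- A chain assigns group elements to edges, and its boundary ∂ sums them at each vertex; a magic
-- labelling is a nowhere zero chain with zero boundary.
--
-- If b is a bridge and G - b has a bipartite component, sum ∂ φ over that component with the signs
-- given by its sides: every other edge cancels, which leaves ± φ b = 0.
--
-- Otherwise each bridge b gets a coordinate of its own.  Both sides of b contain closed walks of odd
-- length through the end of b; alternating ±1 along them gives 2 at the ends, which 2 on b (non-zero
-- modulo 2j, as j ≥ 2) compensates.  The non-bridges are covered by three even edge sets h, p, q,
-- each labelled with the involution j.  They are constructed as in Seymour's proof of the 6-flow
-- theorem.  Grow a set U of vertices connected by edges W: choose a minimal non-empty X outside U
-- that at most one non-bridge joins to the rest of the complement of U.  Then X is 2-edge-connected.
-- If two edges f₁, f₂ join X to U, an even set inside X connecting their ends goes into h, and a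
-- cycle through f₁ and f₂ adjusts p on f₁ and q on f₂ afterwards.  If there is only one, it lies in
-- a cut with one other non-bridge, so it is covered as soon as that one is.

open import Defs
open import Algebra.Bundles using (AbelianGroup; CommutativeMonoid; CommutativeRing)
import Algebra.Properties.AbelianGroup as AbelianGroupProperties
import Algebra.Properties.CommutativeMonoid.Sum as Sum
import Algebra.Solver.CommutativeMonoid as CommutativeMonoidSolver
open import Data.Bool.Base using (Bool; true; false; if_then_else_; not; _∧_; _∨_; _xor_)
import Data.Bool.Properties as Bool
open import Data.Fin.Base using (Fin; zero; suc; toℕ; fromℕ<; punchIn; punchOut; finToFun; funToFin)
open import Data.Fin.Permutation using (↔⇒≡)
open import Data.Fin.Properties
  using (_≟_; any?; all?; toℕ-fromℕ<; punchInᵢ≢i; punchIn-punchOut; finToFun-funToFin)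
open import Data.Fin.Subset as Subset using (Subset; inside; outside; _∈_; _⊂_; Nonempty; ∣_∣)
open import Data.Fin.Subset.Induction using (⊂-wellFounded)
open import Data.Integer.Base as ℤ using (ℤ; +_; 0ℤ)
import Data.Integer.DivMod as ℤ
import Data.Integer.Divisibility.Signed as ℤ∣
import Data.Integer.Properties as ℤ
open import Data.Integer.Tactic.RingSolver using (solve-∀)
open import Data.List.Base using (List; lookup; filter; allFin)
open import Data.List.Membership.Propositional.Properties
  using (∈-allFin; ∈-filter⁺; ∈-filter⁻; ∈-lookup)
import Data.List.Relation.Unary.All as All
open import Data.List.Relation.Unary.Any using (index)
open import Data.List.Relation.Unary.Any.Properties using (lookup-index)
open import Data.List.Relation.Unary.Unique.Propositional using (Unique; _∷_)
import Data.List.Relation.Unary.Unique.Propositional.Properties as Unique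
open import Data.Nat.Base as ℕ using (ℕ; zero; suc; _+_; _*_; _≤_; _<_; s≤s; z≤n; NonZero)
import Data.Nat.Divisibility as ℕ∣
open import Data.Nat.Induction using (<-rec)
import Data.Nat.Properties as ℕ
open import Data.Product.Base using (_×_; _,_; proj₁; proj₂; ∃-syntax; Σ-syntax)
open import Data.Sum.Base using (_⊎_; inj₁; inj₂)
open import Data.Vec.Base using ([]; _∷_; here; there; tabulate)
open import Data.Vec.Properties using (lookup∘tabulate; []=⇒lookup; lookup⇒[]=)
open import Function.Base using (_∘_)
open import Function.Bundles using (Inverse; mk↔ₛ′)
open import Induction.WellFounded using (Acc; acc; WellFounded; module Subrelation)
open import Level using (0ℓ)
open import Relation.Binary.Construct.Add.Supremum.NonStrict _≤_ using (_≤⁺_) renaming ([_] to ≤⁺[_])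
import Relation.Binary.Construct.Closure.Equivalence as EqC
open import Relation.Binary.Construct.Closure.ReflexiveTransitive using (_◅_) renaming (ε to [])
open import Relation.Binary.Construct.Closure.Symmetric using (fwd; bwd)
import Relation.Binary.Construct.On as On
open import Relation.Binary.PropositionalEquality as ≡ using (_≡_; _≢_)
import Relation.Binary.Reasoning.Setoid as ≈-Reasoning
open import Relation.Binary.Structures using (IsEquivalence)
open import Relation.Nullary.Construct.Add.Supremum using ([_])
open import Relation.Nullary.Decidable
  using (Dec; yes; no; does; map′; ¬?; _×-dec_; _⊎-dec_; dec-true; dec-false)
open import Relation.Nullary.Negation using (¬_; contradiction)
open import Relation.Unary using (Pred; Decidable)

witness : ∀ {p} {P : Set p} (P? : Dec P) → does P? ≡ true → P
witness (yes p) _ = p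

refute : ∀ {p} {P : Set p} (P? : Dec P) → does P? ≡ false → ¬ P
refute (no ¬p) _ = ¬p

-- Walks and chains

module SumProperties {c ℓ} (M : CommutativeMonoid c ℓ) where
  open CommutativeMonoid M
  open Sum M

  sum-ε : ∀ {n} (f : Fin n → Carrier) → (∀ i → f i ≈ ε) → sum f ≈ ε
  sum-ε {n} f f≈ε = trans (sum-cong-≋ f≈ε) (sum-replicate-zero n)

  sum-single : ∀ {n} (f : Fin n → Carrier) i → (∀ j → j ≢ i → f j ≈ ε) → sum f ≈ f i
  sum-single {suc n} f i f≈ε = trans (sum-remove f)
    (trans (∙-congˡ (sum-ε _ (λ j → f≈ε (punchIn i j) (punchInᵢ≢i i j)))) (identityʳ _))

module SumHomomorphism {a ℓ₁ b ℓ₂} (M : CommutativeMonoid a ℓ₁) (N : CommutativeMonoid b ℓ₂) where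
  private
    module M = CommutativeMonoid M
    module N = CommutativeMonoid N

  sum-homo : ∀ (h : M.Carrier → N.Carrier) → h M.ε N.≈ N.ε → (∀ x y → h (x M.∙ y) N.≈ h x N.∙ h y) →
             ∀ {n} (f : Fin n → M.Carrier) → h (Sum.sum M f) N.≈ Sum.sum N (h ∘ f)
  sum-homo h h-ε h-∙ {zero}  f = h-ε
  sum-homo h h-ε h-∙ {suc n} f = N.trans (h-∙ _ _) (N.∙-congˡ (sum-homo h h-ε h-∙ (f ∘ suc)))

module Signs {c ℓ} (A : AbelianGroup c ℓ) where
  open AbelianGroup A
  open AbelianGroupProperties A using (⁻¹-∙-comm; ε⁻¹≈ε; ⁻¹-involutive)

  sign : Bool → Carrier → Carrier
  sign true  a = a
  sign false a = a ⁻¹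

  sign-not : ∀ s a → sign (not s) a ≈ (sign s a) ⁻¹
  sign-not true  a = refl
  sign-not false a = sym (⁻¹-involutive a)

  sign-ε : ∀ s → sign s ε ≈ ε
  sign-ε true  = refl
  sign-ε false = ε⁻¹≈ε

  sign-∙ : ∀ s x y → sign s (x ∙ y) ≈ sign s x ∙ sign s y
  sign-∙ true  x y = refl
  sign-∙ false x y = sym (⁻¹-∙-comm x y)

  sign-cong : ∀ s {x y} → x ≈ y → sign s x ≈ sign s y
  sign-cong true  p = p
  sign-cong false p = ⁻¹-cong p

  sign-≈ε : ∀ s {x} → sign s x ≈ ε → x ≈ ε
  sign-≈ε true  p = p
  sign-≈ε false p = trans (sym (⁻¹-involutive _)) (trans (⁻¹-cong p) ε⁻¹≈ε)

  sign-opposite : ∀ {s t} → s ≢ t → ∀ x → sign s x ∙ sign t x ≈ ε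
  sign-opposite {true}  {true}  s≢t x = contradiction ≡.refl s≢t
  sign-opposite {true}  {false} s≢t x = inverseʳ x
  sign-opposite {false} {true}  s≢t x = inverseˡ x
  sign-opposite {false} {false} s≢t x = contradiction ≡.refl s≢t

module Walks (G : Graph) where
  open Graph G

  data Joins (e : Edge) : Vertex → Vertex → Set where
    fwd : Joins e (proj₁ (ends e)) (proj₂ (ends e))
    bwd : Joins e (proj₂ (ends e)) (proj₁ (ends e))

  Joins-sym : ∀ {e u v} → Joins e u v → Joins e v u
  Joins-sym fwd = bwd
  Joins-sym bwd = fwd

  joins? : ∀ e u v → Dec (Joins e u v)
  joins? e u v = map′
    (λ { (inj₁ (≡.refl , ≡.refl)) → fwd ; (inj₂ (≡.refl , ≡.refl)) → bwd })
    (λ { fwd → inj₁ (≡.refl , ≡.refl) ; bwd → inj₂ (≡.refl , ≡.refl) })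
    ((u ≟ proj₁ (ends e) ×-dec v ≟ proj₂ (ends e)) ⊎-dec
     (u ≟ proj₂ (ends e) ×-dec v ≟ proj₁ (ends e)))

  -- Deleted edges are turned into loops, which do not affect walks.
  restrict : (Edge → Bool) → Edge → Vertex × Vertex
  restrict D e = proj₁ (ends e) , (if D e then proj₂ (ends e) else proj₁ (ends e))

  infix 4 _~[_]_ _~[_]?_

  abstract
    label : (D : Edge → Bool) → Vertex → Fin (proj₁ (components (restrict D)))
    label D = Inverse.to (proj₂ (components (restrict D)))

    representative : (Edge → Bool) → Vertex → Vertex
    representative D v = Inverse.from (proj₂ (components (restrict D))) (label D v)

  -- Being joined by a walk in `D` is encoded as equality of component labels, so that it is
  -- decidable and an equivalence for free. The record wrapper lets `u`, `D` and `v` be inferred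
  -- from the type.
  record _~[_]_ (u : Vertex) (D : Edge → Bool) (v : Vertex) : Set where
    constructor walk
    field label-≡ : label D u ≡ label D v

  open _~[_]_ public

  abstract
    _~[_]?_ : ∀ u D v → Dec (u ~[ D ] v)
    u ~[ D ]? v = map′ walk label-≡ (label D u ≟ label D v)

  class : (Edge → Bool) → Vertex → Vertex → Bool
  class D u v = does (u ~[ D ]? v)

  module _ {D : Edge → Bool} where
    private module I = Inverse (proj₂ (components (restrict D)))

    ~-refl : ∀ {u} → u ~[ D ] u
    ~-refl = walk ≡.refl

    ~-sym : ∀ {u v} → u ~[ D ] v → v ~[ D ] u
    ~-sym (walk p) = walk (≡.sym p)

    ~-trans : ∀ {u v w} → u ~[ D ] v → v ~[ D ] w → u ~[ D ] w
    ~-trans (walk p) (walk q) = walk (≡.trans p q)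

    abstract
      ~-edge : ∀ {e u v} → D e ≡ true → Joins e u v → u ~[ D ] v
      ~-edge {e} De fwd = walk (I.to-cong (EqC.return (e , ≡.cong (λ b → _ , (if b then _ else _)) De)))
      ~-edge     De bwd = ~-sym (~-edge De fwd)

      -- Equal labels are turned back into a chain of links through the common representative, which
      -- is followed link by link. A link of a deleted edge is a loop, so `P` passes over it
      -- unchanged.
      ~-induction : ∀ {p} (P : Vertex → Set p) →
                    (∀ e {u v} → D e ≡ true → Joins e u v → P u → P v) →
                    ∀ {u v} → u ~[ D ] v → P u → P v
      ~-induction P step {u} {v} (walk p) = follow
        (EqC.transitive _ (EqC.symmetric _ (I.inverseʳ ≡.refl)) (I.inverseʳ p))
        where
        link⇒P : ∀ {u v} e → restrict D e ≡ (u , v) → (P u → P v) × (P v → P u)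
        link⇒P e ≡.refl with D e in eq
        ... | true  = step e eq fwd , step e eq bwd
        ... | false = (λ Pu → Pu) , (λ Pv → Pv)

        follow : ∀ {u v} → EqC.EqClosure (Link (restrict D)) u v → P u → P v
        follow []                 Pu = Pu
        follow (fwd (e , eq) ◅ w) Pu = follow w (proj₁ (link⇒P e eq) Pu)
        follow (bwd (e , eq) ◅ w) Pu = follow w (proj₂ (link⇒P e eq) Pu)

      ~-representative : ∀ v → v ~[ D ] representative D v
      ~-representative v = walk (≡.sym (I.strictlyInverseˡ _))

      representative-cong : ∀ {u v} → u ~[ D ] v → representative D u ≡ representative D v
      representative-cong (walk p) = ≡.cong I.from p

    class⇒~ : ∀ {u v} → class D u v ≡ true → u ~[ D ] v
    class⇒~ {u} {v} = witness (u ~[ D ]? v)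

    ~⇒class : ∀ {u v} → u ~[ D ] v → class D u v ≡ true
    ~⇒class {u} {v} = dec-true (u ~[ D ]? v)

  ~-mono : ∀ {D D′} → (∀ e → D e ≡ true → D′ e ≡ true) → ∀ {u v} → u ~[ D ] v → u ~[ D′ ] v
  ~-mono D⊆D′ {u} p = ~-induction (u ~[ _ ]_)
    (λ e De e-joins u~ → ~-trans u~ (~-edge (D⊆D′ e De) e-joins)) p ~-refl

module Chains {c ℓ} (A : AbelianGroup c ℓ) (G : Graph) where
  open AbelianGroup A
  open Sum commutativeMonoid
  open SumProperties commutativeMonoid
  open SumHomomorphism commutativeMonoid commutativeMonoid
  open Signs A
  open Graph G
  open Walks G
  open ≈-Reasoning setoid

  Chain : Set c
  Chain = Edge → Carrier

  at : Vertex → Chain → Chain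
  at v φ e = if does (incident? v e) then φ e else ε

  ∂ : Chain → Vertex → Carrier
  ∂ φ v = sum (at v φ)

  point : Vertex → Carrier → Vertex → Carrier
  point u a v = if does (v ≟ u) then a else ε

  single : Edge → Carrier → Chain
  single e a e′ = if does (e′ ≟ e) then a else ε

  private
    if-cong : ∀ b {x y} → x ≈ y → (if b then x else ε) ≈ (if b then y else ε)
    if-cong true  p = p
    if-cong false p = refl

    if-∙ : ∀ b {x y} → (if b then x ∙ y else ε) ≈ (if b then x else ε) ∙ (if b then y else ε)
    if-∙ true  = refl
    if-∙ false = sym (identityˡ ε)

    if-ε : ∀ b {x} → x ≈ ε → (if b then x else ε) ≈ ε
    if-ε true  p = p
    if-ε false p = refl

    if-endo : ∀ (h : Carrier → Carrier) → h ε ≈ ε → ∀ b {x} →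
              h (if b then x else ε) ≈ (if b then h x else ε)
    if-endo h h-ε true  = refl
    if-endo h h-ε false = h-ε

  ∂-cong : ∀ {φ ψ : Chain} → (∀ e → φ e ≈ ψ e) → ∀ v → ∂ φ v ≈ ∂ ψ v
  ∂-cong φ≈ψ v = sum-cong-≋ (λ e → if-cong (does (incident? v e)) (φ≈ψ e))

  ∂-∙ : ∀ (φ ψ : Chain) v → ∂ (λ e → φ e ∙ ψ e) v ≈ ∂ φ v ∙ ∂ ψ v
  ∂-∙ φ ψ v = trans (sum-cong-≋ (λ e → if-∙ (does (incident? v e)))) (∑-distrib-+ (at v φ) (at v ψ))

  ∂-ε : ∀ {φ : Chain} → (∀ e → φ e ≈ ε) → ∀ v → ∂ φ v ≈ ε
  ∂-ε φ≈ε v = sum-ε _ (λ e → if-ε (does (incident? v e)) (φ≈ε e))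

  ∂-sum : ∀ {n} (φ : Fin n → Chain) v → ∂ (λ e → sum (λ i → φ i e)) v ≈ sum (λ i → ∂ (φ i) v)
  ∂-sum {n} φ v = trans (sum-cong-≋ if-sum) (∑-comm (λ e i → if does (incident? v e) then φ i e else ε))
    where
    if-sum : ∀ e → (if does (incident? v e) then sum (λ i → φ i e) else ε) ≈
                   sum (λ i → if does (incident? v e) then φ i e else ε)
    if-sum e with does (incident? v e)
    ... | true  = refl
    ... | false = sym (sum-replicate-zero n)

  ∂-single : ∀ {e u v} a → Joins e u v → ∀ w → ∂ (single e a) w ≈ point u a w ∙ point v a w
  ∂-single {e} a e-joins w = trans
    (sum-single _ e (λ e′ e′≢e → if-ε (does (incident? w e′)) (off e′≢e))) (at-e e-joins)
    where
    off : ∀ {e′} → e′ ≢ e → single e a e′ ≈ ε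
    off {e′} e′≢e rewrite dec-false (e′ ≟ e) e′≢e = refl

    at-e : ∀ {u v} → Joins e u v →
           (if does (incident? w e) then single e a e else ε) ≈ point u a w ∙ point v a w
    at-e fwd rewrite dec-true (e ≟ e) ≡.refl with w ≟ proj₁ (ends e) | w ≟ proj₂ (ends e)
    ... | yes p | yes q = contradiction (≡.trans (≡.sym p) q) (loopless e)
    ... | yes _ | no  _ = sym (identityʳ a)
    ... | no  _ | yes _ = sym (identityˡ a)
    ... | no  _ | no  _ = sym (identityˡ ε)
    at-e bwd = trans (at-e fwd) (comm _ _)

  sum-incident : ∀ (g : Vertex → Carrier) e →
    sum (λ v → if does (incident? v e) then g v else ε) ≈ g (proj₁ (ends e)) ∙ g (proj₂ (ends e))
  sum-incident g e = begin
    sum (λ v → if does (incident? v e) then g v else ε)  ≈⟨ sum-cong-≋ split ⟩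
    sum (λ v → spike (proj₁ (ends e)) v ∙ spike (proj₂ (ends e)) v)
      ≈⟨ ∑-distrib-+ (spike (proj₁ (ends e))) (spike (proj₂ (ends e))) ⟩
    sum (spike (proj₁ (ends e))) ∙ sum (spike (proj₂ (ends e))) ≈⟨ ∙-cong (sum-spike _) (sum-spike _) ⟩
    g (proj₁ (ends e)) ∙ g (proj₂ (ends e)) ∎
    where
    spike : Vertex → Vertex → Carrier
    spike u v = if does (v ≟ u) then g v else ε

    split : ∀ v → (if does (incident? v e) then g v else ε) ≈
                  spike (proj₁ (ends e)) v ∙ spike (proj₂ (ends e)) v
    split v with v ≟ proj₁ (ends e) | v ≟ proj₂ (ends e)
    ... | yes p | yes q = contradiction (≡.trans (≡.sym p) q) (loopless e)
    ... | yes _ | no  _ = sym (identityʳ _)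
    ... | no  _ | yes _ = sym (identityˡ _)
    ... | no  _ | no  _ = sym (identityˡ ε)

    sum-spike : ∀ u → sum (spike u) ≈ g u
    sum-spike u = trans (sum-single (spike u) u off) on
      where
      off : ∀ v → v ≢ u → spike u v ≈ ε
      off v v≢u rewrite dec-false (v ≟ u) v≢u = refl

      on : spike u u ≈ g u
      on rewrite dec-true (u ≟ u) ≡.refl = refl

  -- Double counting of incidences with an additive weight at each vertex. An indicator of a vertex
  -- set as weight gives the parity of a cut; a signed indicator of a bipartite component isolates a
  -- bridge.
  handshake : ∀ (h : Vertex → Carrier → Carrier) → (∀ v → h v ε ≈ ε) →
              (∀ v a b → h v (a ∙ b) ≈ h v a ∙ h v b) → ∀ φ →
              sum (λ v → h v (∂ φ v)) ≈
              sum (λ e → h (proj₁ (ends e)) (φ e) ∙ h (proj₂ (ends e)) (φ e))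
  handshake h h-ε h-∙ φ = begin
    sum (λ v → h v (∂ φ v))
      ≈⟨ sum-cong-≋ (λ v → trans (sum-homo (h v) (h-ε v) (h-∙ v) (at v φ))
           (sum-cong-≋ (λ e → if-endo (h v) (h-ε v) (does (incident? v e))))) ⟩
    sum (λ v → sum (λ e → if does (incident? v e) then h v (φ e) else ε))
      ≈⟨ ∑-comm (λ v e → if does (incident? v e) then h v (φ e) else ε) ⟩
    sum (λ e → sum (λ v → if does (incident? v e) then h v (φ e) else ε))
      ≈⟨ sum-cong-≋ (λ e → sum-incident (λ v → h v (φ e)) e) ⟩
    sum (λ e → h (proj₁ (ends e)) (φ e) ∙ h (proj₂ (ends e)) (φ e)) ∎

  point-cong : ∀ u {a b} → a ≈ b → ∀ w → point u a w ≈ point u b w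
  point-cong u a≈b w = if-cong (does (w ≟ u)) a≈b

  point-∙ : ∀ u a b w → point u (a ∙ b) w ≈ point u a w ∙ point u b w
  point-∙ u a b w = if-∙ (does (w ≟ u))

  point-inverse : ∀ u a w → point u a w ∙ point u (a ⁻¹) w ≈ ε
  point-inverse u a w with does (w ≟ u)
  ... | true  = inverseʳ a
  ... | false = identityˡ ε

  -- The chain carries ±a alternately along a walk.
  walk⇒chain : ∀ {D u v} a → u ~[ D ] v →
    ∃[ s ] ∃[ ψ ] (∀ e → D e ≡ false → ψ e ≈ ε) ×
                  (∀ w → ∂ ψ w ≈ point u a w ∙ point v (sign s a) w)
  walk⇒chain {D} {u} a u~v = ~-induction P step u~v
    -- On the empty walk both points sit at `u`, so the second one must carry the negative sign.
    (false , (λ _ → ε) , (λ _ _ → refl) ,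
     λ w → trans (∂-ε (λ _ → refl) w) (sym (point-inverse u a w)))
    where
    P : Vertex → Set _
    P v = ∃[ s ] ∃[ ψ ] (∀ e → D e ≡ false → ψ e ≈ ε) ×
                        (∀ w → ∂ ψ w ≈ point u a w ∙ point v (sign s a) w)

    step : ∀ e {v v′} → D e ≡ true → Joins e v v′ → P v → P v′
    step e {v} {v′} De e-joins (s , ψ , ψ-support , ∂ψ) =
      not s , ψ′ , support , ∂ψ′
      where
      -- The new edge carries the opposite of what has accumulated at `v`; it cancels that and
      -- leaves its own value at `v′`.
      b = sign (not s) a
      ψ′ : Chain
      ψ′ e′ = ψ e′ ∙ single e b e′

      support : ∀ e′ → D e′ ≡ false → ψ′ e′ ≈ ε
      support e′ De′ with e′ ≟ e
      ... | yes ≡.refl with () ← ≡.trans (≡.sym De) De′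
      ... | no _ = trans (identityʳ _) (ψ-support e′ De′)

      ∂ψ′ : ∀ w → ∂ ψ′ w ≈ point u a w ∙ point v′ b w
      ∂ψ′ w = begin
        ∂ ψ′ w                                                     ≈⟨ ∂-∙ ψ (single e b) w ⟩
        ∂ ψ w ∙ ∂ (single e b) w                                   ≈⟨ ∙-cong (∂ψ w) (∂-single b e-joins w) ⟩
        (point u a w ∙ point v (sign s a) w) ∙ (point v b w ∙ point v′ b w) ≈⟨ assoc _ _ _ ⟩
        point u a w ∙ (point v (sign s a) w ∙ (point v b w ∙ point v′ b w)) ≈⟨ ∙-congˡ (assoc _ _ _) ⟨
        point u a w ∙ ((point v (sign s a) w ∙ point v b w) ∙ point v′ b w)
          ≈⟨ ∙-congˡ (∙-congʳ (∙-congˡ (point-cong v (sign-not s a) w))) ⟩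
        point u a w ∙ ((point v (sign s a) w ∙ point v (sign s a ⁻¹) w) ∙ point v′ b w)
          ≈⟨ ∙-congˡ (∙-congʳ (point-inverse v (sign s a) w)) ⟩
        point u a w ∙ (ε ∙ point v′ b w)                           ≈⟨ ∙-congˡ (identityˡ _) ⟩
        point u a w ∙ point v′ b w                                 ∎

module ChainHomomorphism {a ℓ₁ b ℓ₂} (A : AbelianGroup a ℓ₁) (B : AbelianGroup b ℓ₂) (G : Graph) where
  private
    module A = AbelianGroup A
    module B = AbelianGroup B
    module CA = Chains A G
    module CB = Chains B G
  open Graph G
  open SumHomomorphism A.commutativeMonoid B.commutativeMonoid

  -- Serves three changes of coefficients: negation, the embedding of `𝔽₂` into ℤ/2j, and the
  -- projection of a power to one coordinate.
  ∂-homo : ∀ (h : A.Carrier → B.Carrier) → h A.ε B.≈ B.ε → (∀ x y → h (x A.∙ y) B.≈ h x B.∙ h y) →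
           ∀ φ v → h (CA.∂ φ v) B.≈ CB.∂ (h ∘ φ) v
  ∂-homo h h-ε h-∙ φ v = B.trans (sum-homo h h-ε h-∙ (CA.at v φ))
    (Sum.sum-cong-≋ B.commutativeMonoid at-homo)
    where
    at-homo : ∀ e → h (CA.at v φ e) B.≈ CB.at v (h ∘ φ) e
    at-homo e with does (incident? v e)
    ... | true  = B.refl
    ... | false = h-ε

-- Edge sets modulo 2

∧⁺ : ∀ {x y} → x ≡ true → y ≡ true → x ∧ y ≡ true
∧⁺ ≡.refl ≡.refl = ≡.refl

∧⁻ : ∀ {x y} → x ∧ y ≡ true → x ≡ true × y ≡ true
∧⁻ {true} {true} _ = ≡.refl , ≡.refl

∨⁻ : ∀ {x y} → x ∨ y ≡ true → x ≡ true ⊎ y ≡ true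
∨⁻ {true}  _ = inj₁ ≡.refl
∨⁻ {false} p = inj₂ p

∨⁺ˡ : ∀ {x y} → x ≡ true → x ∨ y ≡ true
∨⁺ˡ ≡.refl = ≡.refl

∨⁺ʳ : ∀ {x y} → y ≡ true → x ∨ y ≡ true
∨⁺ʳ {x} ≡.refl = Bool.∨-zeroʳ x

xor⁻ : ∀ {x y} → x xor y ≡ true → x ≡ true ⊎ y ≡ true
xor⁻ {true}  _ = inj₁ ≡.refl
xor⁻ {false} p = inj₂ p

not⁻ : ∀ {x} → not x ≡ true → x ≡ false
not⁻ {false} _ = ≡.refl

≢true⇒≡false : ∀ {x} → ¬ x ≡ true → x ≡ false
≢true⇒≡false = Bool.¬-not

false≢true : ∀ {x} → x ≡ false → ¬ x ≡ true
false≢true ≡.refl ()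

xor-telescope : ∀ a b c → (a xor b) xor (b xor c) ≡ a xor c
xor-telescope false false c = ≡.refl
xor-telescope false true  c = Bool.not-involutive c
xor-telescope true  false c = ≡.refl
xor-telescope true  true  c = ≡.refl

𝔽₂ : AbelianGroup 0ℓ 0ℓ
𝔽₂ = CommutativeRing.+-abelianGroup Bool.xor-∧-commutativeRing

module EdgeSets (G : Graph) where
  open Graph G
  open Walks G public
  open Chains 𝔽₂ G public
  open Sum (AbelianGroup.commutativeMonoid 𝔽₂) using (sum; sum-cong-≗)
  open SumProperties (AbelianGroup.commutativeMonoid 𝔽₂)
  open SumHomomorphism (AbelianGroup.commutativeMonoid 𝔽₂) (AbelianGroup.commutativeMonoid 𝔽₂)

  EdgeSet VertexSet : Set
  EdgeSet   = Edge → Bool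
  VertexSet = Vertex → Bool

  infix 4 _⊆_
  _⊆_ : EdgeSet → EdgeSet → Set
  P ⊆ Q = ∀ e → P e ≡ true → Q e ≡ true

  infixl 6 _∖_ _∣_
  _∖_ : EdgeSet → Edge → EdgeSet
  (D ∖ e) e′ = D e′ ∧ not (does (e′ ≟ e))

  _∣_ : EdgeSet → VertexSet → EdgeSet
  (D ∣ K) e = D e ∧ (K (proj₁ (ends e)) ∧ K (proj₂ (ends e)))

  infixr 5 _⊕_
  _⊕_ : EdgeSet → EdgeSet → EdgeSet
  (P ⊕ Q) e = P e xor Q e

  -- The even edge sets, that is, the cycle space over `𝔽₂`.
  IsFlow : EdgeSet → Set
  IsFlow C = ∀ v → ∂ C v ≡ false

  -- A T-join for the two vertices `u` and `v`. If they coincide, the two points cancel and the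
  -- condition becomes `IsFlow`.
  Bounds : EdgeSet → Vertex → Vertex → Set
  Bounds P u v = ∀ w → ∂ P w ≡ point u true w xor point v true w

  single-true : ∀ e e′ → single e true e′ ≡ true → e′ ≡ e
  single-true e e′ p with e′ ≟ e
  ... | yes q = q

  single-self : ∀ e → single e true e ≡ true
  single-self e rewrite dec-true (e ≟ e) ≡.refl = ≡.refl

  single-other : ∀ {e e′} → e′ ≢ e → single e true e′ ≡ false
  single-other {e} {e′} e′≢e rewrite dec-false (e′ ≟ e) e′≢e = ≡.refl

  ∖⁻ : ∀ {D e e′} → (D ∖ e) e′ ≡ true → D e′ ≡ true × e′ ≢ e
  ∖⁻ {e = e} {e′} p = proj₁ (∧⁻ p) , refute (e′ ≟ e) (not⁻ (proj₂ (∧⁻ p)))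

  ∖⁺ : ∀ {D e e′} → D e′ ≡ true → e′ ≢ e → (D ∖ e) e′ ≡ true
  ∖⁺ {e = e} {e′} De′ e′≢e = ∧⁺ De′ (≡.cong not (dec-false (e′ ≟ e) e′≢e))

  ∣⁺ : ∀ {D K e u v} → D e ≡ true → Joins e u v → K u ≡ true → K v ≡ true → (D ∣ K) e ≡ true
  ∣⁺ De fwd Ku Kv = ∧⁺ De (∧⁺ Ku Kv)
  ∣⁺ De bwd Ku Kv = ∧⁺ De (∧⁺ Kv Ku)

  ∣⁻ : ∀ {D K e u v} → (D ∣ K) e ≡ true → Joins e u v → D e ≡ true × K u ≡ true × K v ≡ true
  ∣⁻ {D} {K} {e} p e-joins with De , q ← ∧⁻ {D e} p with K₁ , K₂ ← ∧⁻ {K (proj₁ (ends e))} q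
    with e-joins
  ... | fwd = De , K₁ , K₂
  ... | bwd = De , K₂ , K₁

  Bounds-refl : ∀ u → Bounds (λ _ → false) u u
  Bounds-refl u w = ≡.trans (∂-ε (λ _ → ≡.refl) w) (≡.sym (Bool.xor-same (point u true w)))

  Bounds-sym : ∀ {P u v} → Bounds P u v → Bounds P v u
  Bounds-sym {u = u} p w = ≡.trans (p w) (Bool.xor-comm (point u true w) _)

  Bounds-trans : ∀ {P Q u v w} → Bounds P u v → Bounds Q v w → Bounds (P ⊕ Q) u w
  Bounds-trans {P} {Q} {u} {v} {w} p q x = ≡.trans (∂-∙ P Q x)
    (≡.trans (≡.cong₂ _xor_ (p x) (q x)) (xor-telescope (point u true x) (point v true x) (point w true x)))

  Bounds-single : ∀ {e u v} → Joins e u v → Bounds (single e true) u v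
  Bounds-single = ∂-single true

  closed⇒flow : ∀ {P u} → Bounds P u u → IsFlow P
  closed⇒flow {u = u} p w = ≡.trans (p w) (Bool.xor-same (point u true w))

  ⊕-flow : ∀ {P Q} → IsFlow P → IsFlow Q → IsFlow (P ⊕ Q)
  ⊕-flow {P} {Q} p q v = ≡.trans (∂-∙ P Q v) (≡.cong₂ _xor_ (p v) (q v))

  ∧-flow : ∀ b {P} → IsFlow P → IsFlow (λ e → b ∧ P e)
  ∧-flow true  p = p
  ∧-flow false p = ∂-ε (λ _ → ≡.refl)

  -- Negation is the identity modulo 2, so the signs of `walk⇒chain` disappear.
  walk⇒join : ∀ {D u v} → u ~[ D ] v → ∃[ Q ] Q ⊆ D × Bounds Q u v
  walk⇒join {D} {u} {v} u~v with walk⇒chain true u~v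
  ... | s , Q , support , ∂Q =
    Q , (λ e Qe → ≢false⇒≡true (λ De → false≢true (support e De) Qe)) ,
    (λ w → ≡.trans (∂Q w) (≡.cong (λ a → point u true w xor point v a w) (sign-true s)))
    where
    ≢false⇒≡true : ∀ {x} → ¬ x ≡ false → x ≡ true
    ≢false⇒≡true = Bool.¬-not

    open Signs 𝔽₂ using (sign)

    sign-true : ∀ s → sign s true ≡ true
    sign-true true  = ≡.refl
    sign-true false = ≡.refl

  private
    cross : VertexSet → EdgeSet → Edge → Bool
    cross X C e = (X (proj₁ (ends e)) ∧ C e) xor (X (proj₂ (ends e)) ∧ C e)

    -- An edge of `C` with both ends in `X` is counted twice and vanishes modulo 2; only the edges
    -- across the cut remain.
    cut-sum : ∀ X C → sum (λ v → X v ∧ ∂ C v) ≡ sum (cross X C)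
    cut-sum X = handshake (λ v a → X v ∧ a) (λ v → Bool.∧-zeroʳ (X v)) (λ v → Bool.∧-distribˡ-xor (X v))

    cross⁻ : ∀ X C e → cross X C e ≡ true →
             ∃[ a ] ∃[ b ] C e ≡ true × Joins e a b × X a ≡ true × X b ≡ false
    cross⁻ X C e p with X (proj₁ (ends e)) in p₁ | X (proj₂ (ends e)) in p₂ | C e
    ... | true  | false | true = _ , _ , ≡.refl , fwd , p₁ , p₂
    ... | false | true  | true = _ , _ , ≡.refl , bwd , p₂ , p₁
    cross⁻ X C e () | true  | true  | true
    cross⁻ X C e () | true  | true  | false
    cross⁻ X C e () | true  | false | false
    cross⁻ X C e () | false | false | _
    cross⁻ X C e () | false | true  | false

    cross⁺ : ∀ X C {e a b} → C e ≡ true → Joins e a b → X a ≡ true → X b ≡ false → cross X C e ≡ true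
    cross⁺ X C Ce fwd Xa Xb rewrite Ce | Xa | Xb = ≡.refl
    cross⁺ X C Ce bwd Xa Xb rewrite Ce | Xa | Xb = ≡.refl

  -- An even set meets every cut in an even number of edges; `e` as the only crossing would make the
  -- number odd.
  crossing-again : ∀ {C} → IsFlow C → ∀ X {e a b} →
    C e ≡ true → Joins e a b → X a ≡ true → X b ≡ false →
    ∃[ e′ ] ∃[ a′ ] ∃[ b′ ] e′ ≢ e × C e′ ≡ true × Joins e′ a′ b′ × X a′ ≡ true × X b′ ≡ false
  crossing-again {C} C-flow X {e} Ce e-joins Xa Xb
    with any? (λ e′ → ¬? (e′ ≟ e) ×-dec (cross X C e′ Bool.≟ true))
  ... | yes (e′ , e′≢e , p) with a′ , b′ , q ← cross⁻ X C e′ p = e′ , a′ , b′ , e′≢e , q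
  ... | no none = contradiction (≡.trans (≡.sym sum≡true) sum≡false) λ ()
    where
    sum≡true : sum (cross X C) ≡ true
    sum≡true = ≡.trans
      (sum-single (cross X C) e (λ e′ e′≢e → ≢true⇒≡false (λ p → none (e′ , e′≢e , p))))
      (cross⁺ X C Ce e-joins Xa Xb)

    sum≡false : sum (cross X C) ≡ false
    sum≡false = ≡.trans (≡.sym (cut-sum X C)) (sum-ε _ (λ v →
      ≡.trans (≡.cong (X v ∧_) (C-flow v)) (Bool.∧-zeroʳ (X v))))

  class-closed : ∀ {P x e u v} → P e ≡ true → Joins e u v → class P x u ≡ true → class P x v ≡ true
  class-closed Pe e-joins p = ~⇒class (~-trans (class⇒~ p) (~-edge Pe e-joins))

  class-self : ∀ {P} x → class P x x ≡ true
  class-self x = ~⇒class ~-refl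

  -- If `v` lay outside the component `K` of `u` in `P`, the boundary summed over `K` would be 1,
  -- coming from `u` alone, although no edge of `P` leaves `K`.
  join⇒walk : ∀ {P u v} → Bounds P u v → u ~[ P ] v
  join⇒walk {P} {u} {v} ∂P with class P u v in Kv
  ... | true  = class⇒~ Kv
  ... | false = contradiction (≡.trans (≡.sym sum≡true) sum≡false) λ ()
    where
    K = class P u

    at-u : ∀ w → w ≢ u → K w ∧ ∂ P w ≡ false
    at-u w w≢u rewrite ∂P w | dec-false (w ≟ u) w≢u with w ≟ v
    ... | yes ≡.refl rewrite Kv = ≡.refl
    ... | no _ = Bool.∧-zeroʳ (K w)

    sum≡true : sum (λ w → K w ∧ ∂ P w) ≡ true
    sum≡true = ≡.trans (sum-single _ u at-u) (∧⁺ (class-self u) ∂Pu)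
      where
      ∂Pu : ∂ P u ≡ true
      ∂Pu rewrite ∂P u | dec-true (u ≟ u) ≡.refl with u ≟ v
      ... | yes ≡.refl = contradiction (class-self u) (false≢true Kv)
      ... | no _ = ≡.refl

    sum≡false : sum (λ w → K w ∧ ∂ P w) ≡ false
    sum≡false = ≡.trans (cut-sum K P) (sum-ε _ λ e → ≢true⇒≡false λ p →
      let _ , _ , Pe , e-joins , Ka , Kb = cross⁻ K P e p
      in false≢true Kb (class-closed Pe e-joins Ka))

  -- No edge of `Q` leaves `K`, so each has both ends in `K` or none: at vertices of `K` the
  -- restriction loses nothing, and elsewhere nothing of it remains.
  ∂-∣ : ∀ {Q K} → (∀ {e u v} → Q e ≡ true → Joins e u v → K u ≡ true → K v ≡ true) →
        ∀ w → ∂ (Q ∣ K) w ≡ K w ∧ ∂ Q w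
  ∂-∣ {Q} {K} closed w = ≡.trans (sum-cong-≗ pointwise)
    (≡.sym (sum-homo (K w ∧_) (Bool.∧-zeroʳ (K w)) (Bool.∧-distribˡ-xor (K w)) (at w Q)))
    where
    edge : ∀ e {u v} → Joins e u v → (Q ∣ K) e ≡ K u ∧ Q e
    edge e {u} {v} e-joins with Q e in Qe | K u in Ku
    ... | false | k     = ≡.sym (Bool.∧-zeroʳ k)
    ... | true  | true  = ≡.trans (≡.cong (_∧ _) (≡.sym Qe))
        (∣⁺ {Q} {K} Qe e-joins Ku (closed Qe e-joins Ku))
    ... | true  | false = ≢true⇒≡false λ p →
      false≢true Ku (proj₁ (proj₂ (∣⁻ {Q} {K} (≡.trans (≡.cong (_∧ _) Qe) p) e-joins)))

    pointwise : ∀ e → at w (Q ∣ K) e ≡ K w ∧ at w Q e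
    pointwise e with w ≟ proj₁ (ends e) | w ≟ proj₂ (ends e)
    ... | yes ≡.refl | _          = edge e fwd
    ... | no _       | yes ≡.refl = edge e bwd
    ... | no _       | no _       = ≡.sym (Bool.∧-zeroʳ (K w))

  -- The part of `Q` that is cut away lies in other components of `P`, while both ends of the join
  -- lie in the component of `x`.
  Bounds-∣ : ∀ {P Q x u v} → Q ⊆ P → Bounds Q u v →
             class P x u ≡ true → class P x v ≡ true → Bounds (Q ∣ class P x) u v
  Bounds-∣ {P} {Q} {x} {u} {v} Q⊆P ∂Q Ku Kv w =
    ≡.trans (∂-∣ {Q} {K} (λ Qe → class-closed (Q⊆P _ Qe)) w)
      (≡.trans (≡.cong (K w ∧_) (∂Q w)) absorb)
    where
    K = class P x

    absorb : K w ∧ (point u true w xor point v true w) ≡ point u true w xor point v true w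
    absorb with w ≟ u | w ≟ v
    ... | yes ≡.refl | _          rewrite Ku = ≡.refl
    ... | no _       | yes ≡.refl rewrite Kv = ≡.refl
    ... | no _       | no _       = Bool.∧-zeroʳ (K w)

  -- The walk is stopped where it first enters `K`. Every edge used up to then starts outside `K`,
  -- so none has both ends in `K`.
  first-hit : ∀ {D} (K : VertexSet) {x y} → y ~[ D ] x → K y ≡ false → K x ≡ true →
    ∃[ z ] K z ≡ true × y ~[ (λ e → D e ∧ not ((D ∣ K) e)) ] z
  first-hit {D} K {x} {y} y~x Ky Kx with ~-induction P step y~x (inj₂ (Ky , ~-refl))
    where
    D° : EdgeSet
    D° e = D e ∧ not ((D ∣ K) e)

    P : Vertex → Set
    P v = (∃[ z ] K z ≡ true × y ~[ D° ] z) ⊎ (K v ≡ false × y ~[ D° ] v)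

    step : ∀ e {v v′} → D e ≡ true → Joins e v v′ → P v → P v′
    step e De e-joins (inj₁ hit) = inj₁ hit
    step e {v} {v′} De e-joins (inj₂ (Kv , y~v)) with K v′ in Kv′
    ... | true  = inj₁ (v′ , Kv′ , y~v′)
      where
      y~v′ : y ~[ D° ] v′
      y~v′ = ~-trans y~v (~-edge (∧⁺ De (≡.cong not (≢true⇒≡false λ p →
        false≢true Kv (proj₁ (proj₂ (∣⁻ {D} {K} p e-joins)))))) e-joins)
    ... | false = inj₂ (≡.refl , ~-trans y~v (~-edge (∧⁺ De (≡.cong not (≢true⇒≡false λ p →
        false≢true Kv (proj₁ (proj₂ (∣⁻ {D} {K} p e-joins)))))) e-joins))
  ... | inj₁ hit = hit
  ... | inj₂ (Kx′ , _) = contradiction Kx (false≢true Kx′)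

  -- Stands in for the two edge-disjoint paths of Menger's theorem. Joins can be changed by
  -- symmetric differences, with no order of edges to maintain and no repetitions to remove.
  record TwoJoins (D : EdgeSet) (x y : Vertex) : Set where
    field
      P₁ P₂    : EdgeSet
      P₁⊆D     : P₁ ⊆ D
      P₂⊆D     : P₂ ⊆ D
      disjoint : ∀ e → P₁ e ≡ true → ¬ P₂ e ≡ true
      ∂P₁      : Bounds P₁ x y
      ∂P₂      : Bounds P₂ x y

  swapJoins : ∀ {D x y} → TwoJoins D x y → TwoJoins D x y
  swapJoins T = record
    { P₁ = P₂ ; P₂ = P₁ ; P₁⊆D = P₂⊆D ; P₂⊆D = P₁⊆D
    ; disjoint = λ e p q → disjoint e q p ; ∂P₁ = ∂P₂ ; ∂P₂ = ∂P₁ }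
    where open TwoJoins T

  -- The case of two paths in Menger's theorem, by induction along a walk from `x`: a pair of joins
  -- ending at `y` is turned into a pair ending at the neighbour `y′`.
  module Menger {D : EdgeSet} {x : Vertex}
    (no-separating-edge : ∀ e {v} → x ~[ D ] v → x ~[ D ∖ e ] v) where

    -- The rest of P₁ runs from the old end to the new one.
    on-join : ∀ {y y′} (T : TwoJoins D x y) → x ~[ TwoJoins.P₁ T ] y′ → TwoJoins D x y′
    on-join T x~y′ with Q , Q⊆P₁ , ∂Q ← walk⇒join x~y′ = record
      { P₁ = Q
      ; P₂ = P₂ ⊕ (P₁ ⊕ Q)
      ; P₁⊆D = λ e Qe → P₁⊆D e (Q⊆P₁ e Qe)
      ; P₂⊆D = P₂′⊆D
      ; disjoint = disjoint′
      ; ∂P₁ = ∂Q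
      ; ∂P₂ = Bounds-trans ∂P₂ (Bounds-trans (Bounds-sym {P₁} ∂P₁) ∂Q)
      }
      where
      open TwoJoins T

      P₂′⊆D : P₂ ⊕ (P₁ ⊕ Q) ⊆ D
      P₂′⊆D e p with xor⁻ {P₂ e} p
      ... | inj₁ P₂e = P₂⊆D e P₂e
      ... | inj₂ q with xor⁻ {P₁ e} q
      ...   | inj₁ P₁e = P₁⊆D e P₁e
      ...   | inj₂ Qe  = P₁⊆D e (Q⊆P₁ e Qe)

      disjoint′ : ∀ e → Q e ≡ true → ¬ (P₂ ⊕ (P₁ ⊕ Q)) e ≡ true
      disjoint′ e Qe p rewrite Qe | Q⊆P₁ e Qe | Bool.xor-identityʳ (P₂ e) = disjoint e (Q⊆P₁ e Qe) p

    -- One new join runs from `x` to `z` inside `P₁` and then along `S` to `y′`; the other is `P₂`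
    -- followed by `e`. Both old joins are first cut down to their component at `x`, since `S` is
    -- known to avoid only these parts. The edge `e` is not in `R₁`, because `y′` is not in the
    -- component of `x` in `P₁`.
    detour : ∀ {e y y′ z} (T : TwoJoins D x y) (let open TwoJoins T) → D e ≡ true → Joins e y y′ →
             ¬ x ~[ P₁ ] y′ → x ~[ P₁ ] z →
             ∀ {S} → S ⊆ D ∖ e → Bounds S y′ z →
             (∀ e → S e ≡ true → ¬ (P₁ ∣ class P₁ x) e ≡ true) →
             (∀ e → S e ≡ true → ¬ (P₂ ∣ class P₂ x) e ≡ true) →
             TwoJoins D x y′
    detour {e} {y} {y′} {z} T De e-joins x≁y′ x~z {S} S⊆ ∂S S#R₁ S#R₂
      with Q , Q⊆P₁ , ∂Q ← walk⇒join x~z = record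
      { P₁ = R₁ ⊕ S
      ; P₂ = R₂ ⊕ single e true
      ; P₁⊆D = P₁′⊆D
      ; P₂⊆D = P₂′⊆D
      ; disjoint = disjoint′
      ; ∂P₁ = Bounds-trans (Bounds-∣ {P₁} Q⊆P₁ ∂Q (class-self x) (~⇒class x~z)) (Bounds-sym {S} ∂S)
      ; ∂P₂ = Bounds-trans (Bounds-∣ {P₂} (λ _ p → p) ∂P₂ (class-self x) (~⇒class (join⇒walk ∂P₂)))
                           (Bounds-single e-joins)
      }
      where
      open TwoJoins T
      R₁ = Q ∣ class P₁ x
      R₂ = P₂ ∣ class P₂ x

      P₁′⊆D : R₁ ⊕ S ⊆ D
      P₁′⊆D e′ p with xor⁻ {R₁ e′} p
      ... | inj₁ q = P₁⊆D e′ (Q⊆P₁ e′ (proj₁ (∧⁻ q)))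
      ... | inj₂ q = proj₁ (∖⁻ {D} (S⊆ e′ q))

      P₂′⊆D : R₂ ⊕ single e true ⊆ D
      P₂′⊆D e′ p with xor⁻ {R₂ e′} p
      ... | inj₁ q = P₂⊆D e′ (proj₁ (∧⁻ q))
      ... | inj₂ q with ≡.refl ← single-true e e′ q = De

      disjoint′ : ∀ e′ → (R₁ ⊕ S) e′ ≡ true → ¬ (R₂ ⊕ single e true) e′ ≡ true
      disjoint′ e′ p q with xor⁻ {R₁ e′} p | xor⁻ {R₂ e′} q
      ... | inj₁ r₁ | inj₁ r₂ = disjoint e′ (Q⊆P₁ e′ (proj₁ (∧⁻ r₁))) (proj₁ (∧⁻ r₂))
      ... | inj₂ s  | inj₁ r₂ = S#R₂ e′ s r₂
      ... | inj₂ s  | inj₂ t  = proj₂ (∖⁻ {D} (S⊆ e′ s)) (single-true e e′ t)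
      ... | inj₁ r₁ | inj₂ t with ≡.refl ← single-true e e′ t =
        x≁y′ (class⇒~ (proj₂ (proj₂ (∣⁻ {Q} {class P₁ x} r₁ e-joins))))

    extend : ∀ e {y y′} → D e ≡ true → Joins e y y′ →
             x ~[ D ] y × TwoJoins D x y → x ~[ D ] y′ × TwoJoins D x y′
    extend e {y} {y′} De e-joins (x~y , T) = x~y′ , result
      where
      open TwoJoins T
      x~y′ = ~-trans x~y (~-edge De e-joins)

      K : VertexSet
      K v = class P₁ x v ∨ class P₂ x v

      result : TwoJoins D x y′
      result with x ~[ P₁ ]? y′ | x ~[ P₂ ]? y′
      ... | yes p | _     = on-join T p
      ... | no _  | yes p = on-join (swapJoins T) p
      ... | no ¬p | no ¬q
        -- Without `e` there is still a walk from `y′` to `x`; it is followed until it meets the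
        -- component of `x` in one of the two joins, and that join is rerouted.
        with z , Kz , y′~z ← first-hit K (~-sym (no-separating-edge e x~y′))
               (≡.cong₂ _∨_ (dec-false (x ~[ P₁ ]? y′) ¬p) (dec-false (x ~[ P₂ ]? y′) ¬q))
               (∨⁺ˡ (class-self {P₁} x))
        with S , S⊆ , ∂S ← walk⇒join y′~z
        = by-class (∨⁻ Kz)
        where
        avoids : ∀ {P} → (∀ v → class P x v ≡ true → K v ≡ true) →
                  ∀ e′ → S e′ ≡ true → ¬ (P ∣ class P x) e′ ≡ true
        avoids {P} P⊆K e′ Se′ p with _ , p₁ , p₂ ← ∣⁻ {P} {class P x} p fwd =
          false≢true (not⁻ (proj₂ (∧⁻ (S⊆ e′ Se′))))
            (∣⁺ {D ∖ e} {K} (proj₁ (∧⁻ (S⊆ e′ Se′))) fwd (P⊆K _ p₁) (P⊆K _ p₂))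

        S⊆D∖e : S ⊆ D ∖ e
        S⊆D∖e e′ Se′ = proj₁ (∧⁻ (S⊆ e′ Se′))

        by-class : class P₁ x z ≡ true ⊎ class P₂ x z ≡ true → TwoJoins D x y′
        by-class (inj₁ q) = detour T De e-joins ¬p (class⇒~ q) S⊆D∖e ∂S
          (avoids (λ _ → ∨⁺ˡ)) (avoids (λ v → ∨⁺ʳ {class P₁ x v}))
        by-class (inj₂ q) = detour (swapJoins T) De e-joins ¬q (class⇒~ q) S⊆D∖e ∂S
          (avoids (λ v → ∨⁺ʳ {class P₁ x v})) (avoids (λ _ → ∨⁺ˡ))

    two-joins : ∀ {y} → x ~[ D ] y → TwoJoins D x y
    two-joins x~y = proj₂ (~-induction (λ y → x ~[ D ] y × TwoJoins D x y) extend x~y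
      (~-refl , record
        { P₁ = λ _ → false ; P₂ = λ _ → false ; P₁⊆D = λ _ () ; P₂⊆D = λ _ ()
        ; disjoint = λ _ () ; ∂P₁ = Bounds-refl x ; ∂P₂ = Bounds-refl x }))

    -- The sum of two joins with the same ends is even. As they are disjoint, nothing of `P₁`
    -- cancels, so the sum still connects `x` to `y`.
    even-join : ∀ {y} → x ~[ D ] y → ∃[ C ] C ⊆ D × IsFlow C × x ~[ C ] y
    even-join {y} x~y = C , C⊆D , closed⇒flow (Bounds-trans ∂P₁ (Bounds-sym {P₂} ∂P₂)) ,
      ~-mono P₁⊆C (join⇒walk ∂P₁)
      where
      open TwoJoins (two-joins x~y)
      C = P₁ ⊕ P₂

      C⊆D : C ⊆ D
      C⊆D e p with xor⁻ {P₁ e} p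
      ... | inj₁ q = P₁⊆D e q
      ... | inj₂ q = P₂⊆D e q

      P₁⊆C : P₁ ⊆ C
      P₁⊆C e p rewrite p | ≢true⇒≡false (disjoint e p) = ≡.refl

-- Covering bridgeless graphs by three flows

module _ {n : ℕ} where

  _≺_ : (Fin n → Bool) → (Fin n → Bool) → Set
  X ≺ Y = (∀ v → X v ≡ true → Y v ≡ true) × ∃[ v ] Y v ≡ true × X v ≡ false

  ≺-wellFounded : WellFounded _≺_
  ≺-wellFounded = Subrelation.wellFounded ≺⇒⊂ (On.wellFounded tabulate ⊂-wellFounded)
    where
    ≺⇒⊂ : ∀ {X Y} → X ≺ Y → tabulate X ⊂ tabulate Y
    ≺⇒⊂ {X} {Y} (X⊆Y , v , Yv , Xv) =
      (λ {w} w∈X → lookup⇒[]= w _ (≡.trans (lookup∘tabulate Y w)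
        (X⊆Y w (≡.trans (≡.sym (lookup∘tabulate X w)) ([]=⇒lookup w∈X))))) ,
      v , lookup⇒[]= v _ (≡.trans (lookup∘tabulate Y v) Yv) ,
      λ v∈X → false≢true Xv (≡.trans (≡.sym (lookup∘tabulate X v)) ([]=⇒lookup v∈X))

module Cover (G : Graph) where
  open Graph G
  open EdgeSets G
  open Sum (AbelianGroup.commutativeMonoid 𝔽₂) using (sum)
  open SumProperties (AbelianGroup.commutativeMonoid 𝔽₂)

  Joins-unique : ∀ {e a b a′ b′} → Joins e a b → Joins e a′ b′ → a ≡ a′ ⊎ a ≡ b′
  Joins-unique fwd fwd = inj₁ ≡.refl
  Joins-unique fwd bwd = inj₂ ≡.refl
  Joins-unique bwd fwd = inj₂ ≡.refl
  Joins-unique bwd bwd = inj₁ ≡.refl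

  ~-class : ∀ {D x v} → x ~[ D ] v → x ~[ D ∣ class D x ] v
  ~-class {D} {x} x~v = proj₂ (~-induction (λ v → class D x v ≡ true × x ~[ D ∣ class D x ] v)
    (λ e De e-joins (Kv , x~v) → let Kv′ = class-closed {D} De e-joins Kv in
       Kv′ , ~-trans x~v (~-edge (∣⁺ {D} {class D x} De e-joins Kv Kv′) e-joins))
    x~v (class-self {D} x , ~-refl))

  ~-inside : ∀ {D : EdgeSet} (X : VertexSet) → (∀ {e u v} → D e ≡ true → Joins e u v → X v ≡ true) →
             ∀ {u v} → u ~[ D ] v → X u ≡ true → X v ≡ true
  ~-inside X D⊆X = ~-induction (λ v → X v ≡ true) (λ e De e-joins _ → D⊆X De e-joins)

  -- The edge `e₀` need not itself run from `X` to the rest of `R`: when no edge does, any edge can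
  -- be named. This expresses "at most one" without a case distinction.
  Sparse : EdgeSet → VertexSet → VertexSet → Set
  Sparse Γ R X = ∃[ e₀ ] ∀ {e a b} → Γ e ≡ true → Joins e a b →
                 X a ≡ true → R b ≡ true → X b ≡ false → e ≡ e₀

  record Core (Γ : EdgeSet) (R : VertexSet) : Set where
    field
      X         : VertexSet
      X⊆R       : ∀ v → X v ≡ true → R v ≡ true
      x         : Vertex
      Xx        : X x ≡ true
      sparse    : Sparse Γ R X
      connected : ∀ e {u v} → X u ≡ true → X v ≡ true → u ~[ (Γ ∣ X) ∖ e ] v

  -- A minimal sparse set X is 2-edge-connected: if deleting e separates X into S and T,
  -- then e is the only edge between them, and S or T is sparse as well.
  core : ∀ {Γ R} X → Acc _≺_ X → (∀ v → X v ≡ true → R v ≡ true) →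
         ∀ x → X x ≡ true → Sparse Γ R X → Core Γ R
  core {Γ} {R} X (acc smaller) X⊆R x Xx (e₀ , X-sparse)
    with any? (λ e → any? λ u → any? λ v →
           (X u Bool.≟ true) ×-dec (X v Bool.≟ true) ×-dec ¬? (u ~[ (Γ ∣ X) ∖ e ]? v))
  ... | no none = record
    { X = X ; X⊆R = X⊆R ; x = x ; Xx = Xx ; sparse = e₀ , X-sparse
    ; connected = connected }
    where
    connected : ∀ e {u v} → X u ≡ true → X v ≡ true → u ~[ (Γ ∣ X) ∖ e ] v
    connected e {u} {v} Xu Xv with u ~[ (Γ ∣ X) ∖ e ]? v
    ... | yes p = p
    ... | no ¬p = contradiction (e , u , v , Xu , Xv , ¬p) none
  ... | yes (e , u , v , Xu , Xv , u≁v) = split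
    -- Decides whether the exit `e₀` from `X` starts in `S`. If it does, `T` has no exit but `e`;
    -- otherwise `S` has none but `e`. Either half is strictly smaller than `X`.
    (any? λ a → any? λ b → joins? e₀ a b ×-dec (S a Bool.≟ true) ×-dec (X b Bool.≟ false))
    where
    D = (Γ ∣ X) ∖ e
    S T : VertexSet
    S w = X w ∧ class D u w
    T w = X w ∧ not (class D u w)

    Su = ∧⁺ Xu (class-self {D} u)
    Tv = ∧⁺ Xv (≡.cong not (dec-false (u ~[ D ]? v) u≁v))

    S⊆X : ∀ w → S w ≡ true → X w ≡ true
    S⊆X w p = proj₁ (∧⁻ p)

    T⊆X : ∀ w → T w ≡ true → X w ≡ true
    T⊆X w p = proj₁ (∧⁻ p)

    S#T : ∀ {w} → S w ≡ true → ¬ T w ≡ true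
    S#T {w} p q = false≢true (not⁻ (proj₂ (∧⁻ {X w} q))) (proj₂ (∧⁻ {X w} p))

    between : ∀ {e′ a b} → Γ e′ ≡ true → Joins e′ a b → S a ≡ true → T b ≡ true → e′ ≡ e
    between {e′} {a} {b} Γe′ e′-joins Sa Tb with e′ ≟ e
    ... | yes p = p
    ... | no ¬p = contradiction Tb (S#T (∧⁺ (T⊆X b Tb) (class-closed {D}
      (∖⁺ {Γ ∣ X} (∣⁺ {Γ} Γe′ e′-joins (S⊆X a Sa) (T⊆X b Tb)) ¬p) e′-joins (proj₂ (∧⁻ {X a} Sa)))))

    ∉S⇒∈T : ∀ {w} → X w ≡ true → S w ≡ false → T w ≡ true
    ∉S⇒∈T Xw Sw rewrite Xw | Sw = ≡.refl

    ∉T⇒∈S : ∀ {w} → X w ≡ true → T w ≡ false → S w ≡ true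
    ∉T⇒∈S {w} Xw Tw rewrite Xw = ≡.trans (≡.sym (Bool.not-involutive (class D u w))) (≡.cong not Tw)

    split : Dec (∃[ a ] ∃[ b ] Joins e₀ a b × S a ≡ true × X b ≡ false) → Core Γ R
    split (yes (a₀ , b₀ , e₀-joins , Sa₀ , Xb₀)) =
      core T (smaller (T⊆X , u , Xu , ≢true⇒≡false (S#T Su)))
        (λ w p → X⊆R w (T⊆X w p)) v Tv (e , T-sparse)
      where
      T-sparse : ∀ {e′ a b} → Γ e′ ≡ true → Joins e′ a b →
                 T a ≡ true → R b ≡ true → T b ≡ false → e′ ≡ e
      T-sparse {e′} {a} {b} Γe′ e′-joins Ta Rb Tb with X b Bool.≟ true
      ... | yes Xb = between Γe′ (Joins-sym e′-joins) (∉T⇒∈S Xb Tb) Ta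
      ... | no ¬Xb with ≡.refl ← X-sparse Γe′ e′-joins (T⊆X a Ta) Rb (≢true⇒≡false ¬Xb)
                   with Joins-unique e′-joins e₀-joins
      ...   | inj₁ ≡.refl = contradiction Ta (S#T Sa₀)
      ...   | inj₂ ≡.refl = contradiction (T⊆X a Ta) (false≢true Xb₀)
    split (no none) =
      core S (smaller (S⊆X , v , Xv , ≢true⇒≡false (λ Sv → S#T Sv Tv)))
        (λ w p → X⊆R w (S⊆X w p)) u Su (e , S-sparse)
      where
      S-sparse : ∀ {e′ a b} → Γ e′ ≡ true → Joins e′ a b →
                 S a ≡ true → R b ≡ true → S b ≡ false → e′ ≡ e
      S-sparse {e′} {a} {b} Γe′ e′-joins Sa Rb Sb with X b Bool.≟ true
      ... | yes Xb = between Γe′ e′-joins Sa (∉S⇒∈T Xb Sb)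
      ... | no ¬Xb with ≡.refl ← X-sparse Γe′ e′-joins (S⊆X a Sa) Rb (≢true⇒≡false ¬Xb) =
        contradiction (a , b , e′-joins , Sa , ≢true⇒≡false ¬Xb) none

  -- Together the hypotheses say that `Γ` is the union of all even sets. They are what the argument
  -- needs of the set of non-bridges.
  module Bridgeless (Γ : EdgeSet)
    (flow-through : ∀ e → Γ e ≡ true → ∃[ C ] IsFlow C × C e ≡ true)
    (flow⊆Γ : ∀ {C} → IsFlow C → C ⊆ Γ)
    where

    rep : Vertex → Vertex
    rep = representative Γ

    -- The representatives serve as roots, one in each component of `Γ`. All of them lie in `U`, and
    -- `to-rep` makes the part of `U` in each component connected by `W`.
    record State (U : VertexSet) (W : EdgeSet) : Set where
      field
        W⊆Γ      : W ⊆ Γ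
        W-inside : ∀ {e u v} → W e ≡ true → Joins e u v → U u ≡ true
        to-rep   : ∀ {u} → U u ≡ true → u ~[ W ] rep u
        rep∈U    : ∀ v → U (rep v) ≡ true

    -- Edges of `W` are exempt from being covered: on the way back from the recursion, each growth
    -- step covers those that it added. Keeping `h` off `U` leaves room to add to it an even set
    -- inside the vertices just absorbed.
    record Covering (U : VertexSet) (W : EdgeSet) : Set where
      field
        h p q     : EdgeSet
        h-flow    : IsFlow h
        p-flow    : IsFlow p
        q-flow    : IsFlow q
        h-outside : ∀ {e u v} → h e ≡ true → Joins e u v → U u ≡ false
        covers    : ∀ e → Γ e ≡ true → h e ≡ false → W e ≡ false → p e ∨ q e ≡ true

    connected-in : ∀ {U W} → State U W → ∀ {u v} → u ~[ Γ ] v → U u ≡ true → U v ≡ true → u ~[ W ] v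
    connected-in st u~v Uu Uv = ~-trans
      (≡.subst (_ ~[ _ ]_) (representative-cong u~v) (to-rep Uu)) (~-sym (to-rep Uv))
      where open State st

    -- Each edge of `Γ` outside `W` closes a cycle with a join in `W`. In the sum of these cycles
    -- every such edge occurs exactly once.
    spanning : ∀ {U W} → State U W → (∀ v → U v ≡ true) → Covering U W
    spanning {U} {W} st U-all = record
      { h = λ _ → false
      ; p = λ e′ → sum (λ e → cycle e e′)
      ; q = λ _ → false
      ; h-flow = ∂-ε (λ _ → ≡.refl)
      ; p-flow = λ v → ≡.trans (∂-sum cycle v) (sum-ε _ (λ e → cycle-flow e v))
      ; q-flow = ∂-ε (λ _ → ≡.refl)
      ; h-outside = λ ()
      ; covers = λ e Γe _ We → ∨⁺ˡ (≡.trans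
          (sum-single _ e (λ e′ e′≢e → cycle-other (≡.≢-sym e′≢e) We))
          (cycle-self (∧⁺ Γe (≡.cong not We))))
      }
      where
      fundamental : ∀ e → ∃[ C ] IsFlow C × (Γ e ∧ not (W e) ≡ true → C e ≡ true) ×
                                 (∀ {e′} → e′ ≢ e → W e′ ≡ false → C e′ ≡ false)
      fundamental e with Γ e ∧ not (W e) in eq
      ... | false = (λ _ → false) , ∂-ε (λ _ → ≡.refl) , (λ ()) , (λ _ _ → ≡.refl)
      ... | true with Q , Q⊆W , ∂Q ← walk⇒join (connected-in st
                        (~-edge {e = e} (proj₁ (∧⁻ eq)) bwd) (U-all _) (U-all _)) =
        single e true ⊕ Q , closed⇒flow (Bounds-trans (Bounds-single fwd) ∂Q) ,
        (λ _ → ≡.cong₂ _xor_ (single-self e) (≢true⇒≡false λ Qe →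
           false≢true (not⁻ (proj₂ (∧⁻ {Γ e} eq))) (Q⊆W e Qe))) ,
        λ e′≢e We′ → ≡.cong₂ _xor_ (single-other e′≢e) (≢true⇒≡false λ Qe′ →
           false≢true We′ (Q⊆W _ Qe′))

      cycle : Edge → EdgeSet
      cycle e = proj₁ (fundamental e)

      cycle-flow : ∀ e → IsFlow (cycle e)
      cycle-flow e = proj₁ (proj₂ (fundamental e))

      cycle-self : ∀ {e} → Γ e ∧ not (W e) ≡ true → cycle e e ≡ true
      cycle-self {e} = proj₁ (proj₂ (proj₂ (fundamental e)))

      cycle-other : ∀ {e e′} → e′ ≢ e → W e′ ≡ false → cycle e e′ ≡ false
      cycle-other {e} = proj₂ (proj₂ (proj₂ (fundamental e)))

    record Extension (U K : VertexSet) (D F : EdgeSet) : Set where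
      field
        D⊆Γ      : D ⊆ Γ
        F⊆Γ      : F ⊆ Γ
        D-inside : ∀ {e u v} → D e ≡ true → Joins e u v → K u ≡ true
        F-inside : ∀ {e u v} → F e ≡ true → Joins e u v → U u ∨ K u ≡ true
        {a b}    : Vertex
        {f}      : Edge
        K⇒~      : ∀ {k} → K k ≡ true → a ~[ D ] k
        Ub       : U b ≡ true
        Ff       : F f ≡ true
        f-joins  : Joins f a b

    extend : ∀ {U W K D F} → State U W → Extension U K D F →
             State (λ v → U v ∨ K v) (λ e → W e ∨ (D e ∨ F e))
    extend {U} {W} {K} {D} {F} st ext = record
      { W⊆Γ = W′⊆Γ
      ; W-inside = W′-inside
      ; to-rep = λ {u} p → to-rep′ (∨⁻ {U u} p)
      ; rep∈U = λ v → ∨⁺ˡ (rep∈U v)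
      }
      where
      open State st
      open Extension ext

      W′ : EdgeSet
      W′ e = W e ∨ (D e ∨ F e)

      D⊆W′ : D ⊆ W′
      D⊆W′ e De = ∨⁺ʳ {W e} (∨⁺ˡ De)

      W′⊆Γ : W′ ⊆ Γ
      W′⊆Γ e p with ∨⁻ {W e} p
      ... | inj₁ We = W⊆Γ e We
      ... | inj₂ q with ∨⁻ {D e} q
      ...   | inj₁ De = D⊆Γ e De
      ...   | inj₂ Fe = F⊆Γ e Fe

      W′-inside : ∀ {e u v} → W′ e ≡ true → Joins e u v → U u ∨ K u ≡ true
      W′-inside {e} {u} p e-joins with ∨⁻ {W e} p
      ... | inj₁ We = ∨⁺ˡ (W-inside We e-joins)
      ... | inj₂ q with ∨⁻ {D e} q
      ...   | inj₁ De = ∨⁺ʳ {U u} (D-inside De e-joins)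
      ...   | inj₂ Fe = F-inside Fe e-joins

      to-rep′ : ∀ {u} → U u ≡ true ⊎ K u ≡ true → u ~[ W′ ] rep u
      to-rep′ (inj₁ Uu) = ~-mono (λ e → ∨⁺ˡ) (to-rep Uu)
      to-rep′ {u} (inj₂ Ku) = ≡.subst (u ~[ W′ ]_) (≡.sym (representative-cong (~-mono W′⊆Γ u~b)))
        (~-trans u~b (~-mono (λ e → ∨⁺ˡ) (to-rep Ub)))
        where
        u~b : u ~[ W′ ] b
        u~b = ~-trans (~-sym (~-mono D⊆W′ (K⇒~ Ku)))
                      (~-edge (∨⁺ʳ {W f} (∨⁺ʳ {D f} Ff)) f-joins)

    module Grow {U : VertexSet} {W : EdgeSet} (st : State U W) (cr : Core Γ (not ∘ U)) where
      open State st
      open Core cr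

      e₀ : Edge
      e₀ = proj₁ sparse

      X#U : ∀ {v} → X v ≡ true → U v ≡ false
      X#U {v} Xv = not⁻ (X⊆R v Xv)

      U#X : ∀ {v} → U v ≡ true → X v ≡ false
      U#X Uv = ≢true⇒≡false (λ Xv → false≢true (X#U Xv) Uv)

      Attached : Edge → Vertex → Vertex → Set
      Attached e a b = Γ e ≡ true × Joins e a b × X a ≡ true × U b ≡ true

      attached? : ∀ e a b → Dec (Attached e a b)
      attached? e a b = (Γ e Bool.≟ true) ×-dec joins? e a b ×-dec (X a Bool.≟ true) ×-dec (U b Bool.≟ true)

      -- The edge lies on an even set, which must leave `X` a second time: either into `U` or, by
      -- sparseness, along `e₀`.
      exit : ∀ {e a b} → Γ e ≡ true → Joins e a b → X a ≡ true → X b ≡ false →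
             (∃[ f ] f ≢ e × ∃[ a′ ] ∃[ b′ ] Attached f a′ b′) ⊎
             (e₀ ≢ e × Γ e₀ ≡ true × ∃[ a′ ] ∃[ b′ ] Joins e₀ a′ b′ × X a′ ≡ true × X b′ ≡ false)
      exit {e} Γe e-joins Xa Xb with C , C-flow , Ce ← flow-through e Γe
        with f , a′ , b′ , f≢e , Cf , f-joins , Xa′ , Xb′ ← crossing-again C-flow X Ce e-joins Xa Xb
        with U b′ in Ub′
      ... | true  = inj₁ (f , f≢e , a′ , b′ , flow⊆Γ C-flow f Cf , f-joins , Xa′ , Ub′)
      ... | false with ≡.refl ← proj₂ sparse (flow⊆Γ C-flow f Cf) f-joins Xa′ (≡.cong not Ub′) Xb′ =
        inj₂ (f≢e , flow⊆Γ C-flow f Cf , a′ , b′ , f-joins , Xa′ , Xb′)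

      decrease : ∀ {K : VertexSet} {a} → X a ≡ true → K a ≡ true → (λ v → not (U v ∨ K v)) ≺ (not ∘ U)
      decrease {K} {a} Xa Ka =
        (λ v p → ≡.cong not (Bool.∨-conicalˡ (U v) _ (not⁻ p))) ,
        a , ≡.cong not (X#U Xa) , ≡.cong not (∨⁺ʳ {U a} Ka)

      -- Otherwise an edge leaving `X` could only be `e₀`, and its second crossing from `exit` would
      -- have to be `e₀` again. Hence `X` would be closed under `Γ`, although the representative of
      -- `x` lies in `U`.
      attachment : ∃[ f ] ∃[ a ] ∃[ b ] Attached f a b
      attachment with any? (λ f → any? λ a → any? λ b → attached? f a b)
      ... | yes p = p
      ... | no none = contradiction (rep∈U x) (false≢true (X#U (closed (~-representative x) Xx)))
        where
        step : ∀ e {u v} → Γ e ≡ true → Joins e u v → X u ≡ true → X v ≡ true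
        step e {u} {v} Γe e-joins Xu with X v in Xv
        ... | true = ≡.refl
        ... | false with exit Γe e-joins Xu Xv
        ...   | inj₁ (f , _ , p) = contradiction (f , p) none
        ...   | inj₂ (e₀≢e , _) with U v in Uv
        ...     | true  = contradiction (e , u , v , Γe , e-joins , Xu , Uv) none
        ...     | false = contradiction (≡.sym (proj₂ sparse Γe e-joins Xu (≡.cong not Uv) Xv)) e₀≢e

        closed : ∀ {u v} → u ~[ Γ ] v → X u ≡ true → X v ≡ true
        closed = ~-induction (λ v → X v ≡ true) step

      -- The edges of Γ leaving X are f and e₀ only, so every flow agrees on f and e₀.
      module Single {f a b} (f-attached : Attached f a b)
        (only : ¬ (∃[ f′ ] f′ ≢ f × ∃[ a′ ] ∃[ b′ ] Attached f′ a′ b′)) where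
        Γf      = proj₁ f-attached
        f-joins = proj₁ (proj₂ f-attached)
        Xa      = proj₁ (proj₂ (proj₂ f-attached))
        Ub      = proj₂ (proj₂ (proj₂ f-attached))

        K : VertexSet
        K v = does (v ≟ a)

        K⇒≡ : ∀ {v} → K v ≡ true → v ≡ a
        K⇒≡ {v} = witness (v ≟ a)

        Ka : K a ≡ true
        Ka = dec-true (a ≟ a) ≡.refl

        D F : EdgeSet
        D _ = false
        F = single f true

        F⇒≡ : ∀ e → F e ≡ true → e ≡ f
        F⇒≡ e = single-true f e

        extension : Extension U K D F
        extension = record
          { D⊆Γ = λ _ ()
          ; F⊆Γ = λ e p → ≡.subst (λ e → Γ e ≡ true) (≡.sym (F⇒≡ e p)) Γf
          ; D-inside = λ ()
          ; F-inside = F-inside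
          ; K⇒~ = λ p → ≡.subst (a ~[ D ]_) (≡.sym (K⇒≡ p)) ~-refl
          ; Ub = Ub
          ; Ff = single-self f
          ; f-joins = f-joins
          }
          where
          F-inside : ∀ {e u v} → F e ≡ true → Joins e u v → U u ∨ K u ≡ true
          F-inside {e} {u} Fe e-joins with ≡.refl ← F⇒≡ e Fe with Joins-unique e-joins f-joins
          ... | inj₁ ≡.refl = ∨⁺ʳ {U u} Ka
          ... | inj₂ ≡.refl = ∨⁺ˡ Ub

        covering : Covering (λ v → U v ∨ K v) (λ e → W e ∨ (D e ∨ F e)) → Covering U W
        covering C = record
          { h = h ; p = p ; q = q ; h-flow = h-flow ; p-flow = p-flow ; q-flow = q-flow
          ; h-outside = λ {e} {u} he e-joins → Bool.∨-conicalˡ (U u) _ (h-outside he e-joins)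
          ; covers = covers′
          }
          where
          open Covering C

          transfer : ∀ {C} → IsFlow C → ∀ {a′ b′} → Joins e₀ a′ b′ → X a′ ≡ true → X b′ ≡ false →
                     C e₀ ≡ true → C f ≡ true
          transfer C-flow e₀-joins Xa′ Xb′ Ce₀
            with g , a″ , b″ , g≢e₀ , Cg , g-joins , Xa″ , Xb″ ← crossing-again C-flow X Ce₀ e₀-joins Xa′ Xb′
            with U b″ in Ub″
          ... | false = contradiction
            (proj₂ sparse (flow⊆Γ C-flow g Cg) g-joins Xa″ (≡.cong not Ub″) Xb″) g≢e₀
          ... | true with g ≟ f
          ...   | yes ≡.refl = Cg
          ...   | no g≢f = contradiction
            (g , g≢f , a″ , b″ , flow⊆Γ C-flow g Cg , g-joins , Xa″ , Ub″) only

          -- The second exit `e₀` is not in the enlarged `W`. It is not in `h` either, since `h`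
          -- would then contain `f`, which has an end in `U`. So `p` or `q` contains `e₀`, and with
          -- it `f`.
          f-covered : p f ∨ q f ≡ true
          f-covered with exit Γf f-joins Xa (U#X Ub)
          ... | inj₁ other = contradiction other only
          ... | inj₂ (e₀≢f , Γe₀ , a′ , b′ , e₀-joins , Xa′ , Xb′)
            with ∨⁻ {p e₀} (covers e₀ Γe₀ he₀ (≡.cong₂ _∨_ We₀ (single-other e₀≢f)))
            where
            We₀ : W e₀ ≡ false
            We₀ = ≢true⇒≡false λ We₀ → false≢true (X#U Xa′) (W-inside We₀ e₀-joins)

            he₀ : h e₀ ≡ false
            he₀ = ≢true⇒≡false λ he₀ → false≢true
              (h-outside (transfer h-flow e₀-joins Xa′ Xb′ he₀) (Joins-sym f-joins)) (∨⁺ˡ Ub)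
          ...   | inj₁ pe₀ = ∨⁺ˡ (transfer p-flow e₀-joins Xa′ Xb′ pe₀)
          ...   | inj₂ qe₀ = ∨⁺ʳ {p f} (transfer q-flow e₀-joins Xa′ Xb′ qe₀)

          covers′ : ∀ e → Γ e ≡ true → h e ≡ false → W e ≡ false → p e ∨ q e ≡ true
          covers′ e Γe he We with e ≟ f
          ... | yes ≡.refl = f-covered
          ... | no e≢f = covers e Γe he (≡.cong₂ _∨_ We (single-other e≢f))

      -- By Menger inside `X` an even set connects `a₁` to `a₂`. Its component at `a₁` is absorbed
      -- into `U`, together with both attaching edges.
      module Double {f₁ a₁ b₁ f₂ a₂ b₂} (f₁-attached : Attached f₁ a₁ b₁)
        (f₂-attached : Attached f₂ a₂ b₂) (f₂≢f₁ : f₂ ≢ f₁) where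
        Γf₁      = proj₁ f₁-attached
        f₁-joins = proj₁ (proj₂ f₁-attached)
        Xa₁      = proj₁ (proj₂ (proj₂ f₁-attached))
        Ub₁      = proj₂ (proj₂ (proj₂ f₁-attached))
        Γf₂      = proj₁ f₂-attached
        f₂-joins = proj₁ (proj₂ f₂-attached)
        Xa₂      = proj₁ (proj₂ (proj₂ f₂-attached))
        Ub₂      = proj₂ (proj₂ (proj₂ f₂-attached))

        Γ[X] : EdgeSet
        Γ[X] = Γ ∣ X

        X-closed : ∀ {v} → a₁ ~[ Γ[X] ] v → X v ≡ true
        X-closed a₁~v = ~-inside X (λ p e-joins → proj₂ (proj₂ (∣⁻ {Γ} {X} p e-joins))) a₁~v Xa₁

        ∖⊆ : ∀ {e} → Γ[X] ∖ e ⊆ Γ[X]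
        ∖⊆ e′ p = proj₁ (∧⁻ p)

        abstract
          even : ∃[ C ] C ⊆ Γ[X] × IsFlow C × a₁ ~[ C ] a₂
          even = Menger.even-join (λ e a₁~v → connected e Xa₁ (X-closed a₁~v))
            -- Only connectedness of `X` is wanted here; `f₁` is an arbitrary choice of the edge to
            -- delete.
            (~-mono ∖⊆ (connected f₁ Xa₁ Xa₂))

        C : EdgeSet
        C = proj₁ even

        K : VertexSet
        K = class C a₁

        D F : EdgeSet
        D = C ∣ K
        F e = single f₁ true e ∨ single f₂ true e

        D⊆C : D ⊆ C
        D⊆C e p = proj₁ (∧⁻ p)

        C⊆Γ[X] : C ⊆ Γ[X]
        C⊆Γ[X] = proj₁ (proj₂ even)

        a₁~a₂ : a₁ ~[ C ] a₂
        a₁~a₂ = proj₂ (proj₂ (proj₂ even))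

        D-flow : IsFlow D
        D-flow w = ≡.trans (∂-∣ {C} {K} (λ Ce → class-closed Ce) w)
          (≡.trans (≡.cong (K w ∧_) (proj₁ (proj₂ (proj₂ even)) w)) (Bool.∧-zeroʳ (K w)))

        D-in-X : ∀ {e u v} → D e ≡ true → Joins e u v → X u ≡ true
        D-in-X {e} De e-joins = proj₁ (proj₂ (∣⁻ {Γ} {X} (C⊆Γ[X] e (D⊆C e De)) e-joins))

        F⁻ : ∀ e → F e ≡ true → e ≡ f₁ ⊎ e ≡ f₂
        F⁻ e p with ∨⁻ {single f₁ true e} p
        ... | inj₁ q = inj₁ (single-true f₁ e q)
        ... | inj₂ q = inj₂ (single-true f₂ e q)

        extension : Extension U K D F
        extension = record
          { D⊆Γ = λ e De → proj₁ (∧⁻ (C⊆Γ[X] e (D⊆C e De)))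
          ; F⊆Γ = F⊆Γ
          ; D-inside = λ De e-joins → proj₁ (proj₂ (∣⁻ {C} {K} De e-joins))
          ; F-inside = F-inside
          ; K⇒~ = λ Kk → ~-class (class⇒~ Kk)
          ; Ub = Ub₁
          ; Ff = ∨⁺ˡ (single-self f₁)
          ; f-joins = f₁-joins
          }
          where
          F⊆Γ : F ⊆ Γ
          F⊆Γ e Fe with F⁻ e Fe
          ... | inj₁ ≡.refl = Γf₁
          ... | inj₂ ≡.refl = Γf₂

          F-inside : ∀ {e u v} → F e ≡ true → Joins e u v → U u ∨ K u ≡ true
          F-inside {e} {u} Fe e-joins with F⁻ e Fe
          F-inside {e} {u} Fe e-joins | inj₁ ≡.refl with Joins-unique e-joins f₁-joins
          ... | inj₁ ≡.refl = ∨⁺ʳ {U u} (class-self {C} a₁)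
          ... | inj₂ ≡.refl = ∨⁺ˡ Ub₁
          F-inside {e} {u} Fe e-joins | inj₂ ≡.refl with Joins-unique e-joins f₂-joins
          ... | inj₁ ≡.refl = ∨⁺ʳ {U u} (~⇒class a₁~a₂)
          ... | inj₂ ≡.refl = ∨⁺ˡ Ub₂

        b₂~b₁ : b₂ ~[ W ] b₁
        b₂~b₁ = connected-in st (~-trans (~-edge Γf₂ (Joins-sym f₂-joins))
          (~-trans (~-sym (~-mono C⊆Γ a₁~a₂)) (~-edge Γf₁ f₁-joins))) Ub₂ Ub₁
          where
          C⊆Γ : C ⊆ Γ
          C⊆Γ e Ce = proj₁ (∧⁻ (C⊆Γ[X] e Ce))

        -- Runs from `a₁` to `a₂` in `D`, over `f₂` to `b₂`, through `W` to `b₁` and back over `f₁`.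
        -- The first stretch stays in `X` and the third in `U`, so `f₁` and `f₂` are used once each.
        cycle : ∃[ Z ] IsFlow Z × Z f₁ ≡ true × Z f₂ ≡ true ×
                       (∀ {e} → W e ∨ (D e ∨ F e) ≡ false → Z e ≡ false)
        cycle with Q₁ , Q₁⊆D , ∂Q₁ ← walk⇒join (~-class a₁~a₂)
              with Q₂ , Q₂⊆W , ∂Q₂ ← walk⇒join b₂~b₁ =
          Z , closed⇒flow (Bounds-trans ∂Q₁ (Bounds-trans (Bounds-single f₂-joins)
                (Bounds-trans ∂Q₂ (Bounds-single (Joins-sym f₁-joins))))) ,
          at-f₁ , at-f₂ , off
          where
          Z : EdgeSet
          Z = Q₁ ⊕ single f₂ true ⊕ Q₂ ⊕ single f₁ true

          Q₁-off : ∀ {e a b} → Attached e a b → Q₁ e ≡ false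
          Q₁-off (_ , e-joins , Xa , Ub) = ≢true⇒≡false λ Q₁e →
            false≢true (U#X Ub) (D-in-X (Q₁⊆D _ Q₁e) (Joins-sym e-joins))

          Q₂-off : ∀ {e a b} → Attached e a b → Q₂ e ≡ false
          Q₂-off (_ , e-joins , Xa , Ub) = ≢true⇒≡false λ Q₂e →
            false≢true (X#U Xa) (W-inside (Q₂⊆W _ Q₂e) e-joins)

          at-f₁ : Z f₁ ≡ true
          at-f₁ rewrite Q₁-off f₁-attached | Q₂-off f₁-attached
                      | single-other (≡.≢-sym f₂≢f₁) = single-self f₁

          at-f₂ : Z f₂ ≡ true
          at-f₂ rewrite Q₁-off f₂-attached | Q₂-off f₂-attached
                      | single-other f₂≢f₁ | single-self f₂ = ≡.refl

          off : ∀ {e} → W e ∨ (D e ∨ F e) ≡ false → Z e ≡ false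
          off {e} p
            rewrite ≢true⇒≡false {Q₁ e} (λ Q₁e → false≢true p (∨⁺ʳ {W e} (∨⁺ˡ (Q₁⊆D e Q₁e))))
                  | ≢true⇒≡false {single f₂ true e}
                      (λ s → false≢true p (∨⁺ʳ {W e} (∨⁺ʳ {D e} (∨⁺ʳ {single f₁ true e} s))))
                  | ≢true⇒≡false {Q₂ e} (λ Q₂e → false≢true p (∨⁺ˡ (Q₂⊆W e Q₂e)))
                  = ≢true⇒≡false (λ s → false≢true p (∨⁺ʳ {W e} (∨⁺ʳ {D e} (∨⁺ˡ s))))

        covering : Covering (λ v → U v ∨ K v) (λ e → W e ∨ (D e ∨ F e)) → Covering U W
        covering C′ with Z , Z-flow , Zf₁ , Zf₂ , Z-off ← cycle = record
          { h = h′ ; p = p′ ; q = q′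
          ; h-flow = ⊕-flow h-flow D-flow
          ; p-flow = ⊕-flow p-flow (∧-flow (not (p f₁)) Z-flow)
          ; q-flow = ⊕-flow q-flow (∧-flow (not (q f₂)) Z-flow)
          ; h-outside = h′-outside
          ; covers = covers′
          }
          where
          open Covering C′

          h′ p′ q′ : EdgeSet
          h′ = h ⊕ D
          -- `Z` is added only if `p` misses `f₁`, and then switches it on; likewise for `q` and
          -- `f₂`. Two sets are needed because one could not be corrected on both edges
          -- independently. Outside `W`, `D` and `F` nothing changes.
          p′ = p ⊕ (λ e → not (p f₁) ∧ Z e)
          q′ = q ⊕ (λ e → not (q f₂) ∧ Z e)

          h′-outside : ∀ {e u v} → h′ e ≡ true → Joins e u v → U u ≡ false
          h′-outside {e} {u} he e-joins with xor⁻ {h e} he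
          ... | inj₁ he = Bool.∨-conicalˡ (U u) _ (h-outside he e-joins)
          ... | inj₂ De = X#U (D-in-X De e-joins)

          flip : ∀ x {z} → z ≡ true → x xor (not x ∧ z) ≡ true
          flip true  ≡.refl = ≡.refl
          flip false ≡.refl = ≡.refl

          keep : ∀ x y {z} → z ≡ false → x xor (y ∧ z) ≡ x
          keep x y ≡.refl rewrite Bool.∧-zeroʳ y = Bool.xor-identityʳ x

          covers′ : ∀ e → Γ e ≡ true → h′ e ≡ false → W e ≡ false → p′ e ∨ q′ e ≡ true
          covers′ e Γe h′e We with e ≟ f₁ | e ≟ f₂
          ... | yes ≡.refl | _          = ∨⁺ˡ (flip (p f₁) Zf₁)
          ... | no _       | yes ≡.refl = ∨⁺ʳ {p′ f₂} (flip (q f₂) Zf₂)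
          ... | no e≢f₁    | no e≢f₂    = ≡.trans
            (≡.cong₂ _∨_ (keep (p e) (not (p f₁)) (Z-off off)) (keep (q e) (not (q f₂)) (Z-off off)))
            (covers e Γe he off)
            where
            -- `D` lies inside `K`, which `h` avoids, so the two are disjoint and an edge missing
            -- from their sum is missing from both.
            De : D e ≡ false
            De = ≢true⇒≡false λ De → false≢true h′e (≡.cong₂ _xor_ {y = false}
              (≢true⇒≡false λ he → false≢true (h-outside he fwd)
                (∨⁺ʳ {U _} (proj₁ (proj₂ (∣⁻ {C} {K} De fwd))))) De)

            he : h e ≡ false
            he = ≡.trans (≡.sym (Bool.xor-identityʳ (h e))) (≡.trans (≡.cong (h e xor_) (≡.sym De)) h′e)

            off : W e ∨ (D e ∨ F e) ≡ false
            off = ≡.cong₂ _∨_ We (≡.cong₂ _∨_ De (≡.cong₂ _∨_ (single-other e≢f₁) (single-other e≢f₂)))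

      grow : (∀ {U′ W′} → (not ∘ U′) ≺ (not ∘ U) → State U′ W′ → Covering U′ W′) → Covering U W
      grow recurse with f , a , b , f-attached ← attachment
        with any? (λ f′ → ¬? (f′ ≟ f) ×-dec any? λ a′ → any? λ b′ → attached? f′ a′ b′)
      ... | no only = covering
        (recurse (decrease (proj₁ (proj₂ (proj₂ f-attached))) Ka) (extend st extension))
        where open Single f-attached only
      ... | yes (f′ , f′≢f , a′ , b′ , f′-attached) =
        covering (recurse (decrease Xa₁ (class-self {C} a)) (extend st extension))
        where open Double f-attached f′-attached f′≢f

    solve : Edge → ∀ {U W} → Acc _≺_ (not ∘ U) → State U W → Covering U W
    solve e₀ {U} {W} (acc smaller) st with any? (λ v → U v Bool.≟ false)
    ... | no none = spanning st (λ v → Bool.¬-not (λ Uv → none (v , Uv)))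
    ... | yes (x , Ux) = Grow.grow st
      -- The descent to a minimal set starts from the whole complement of `U`, which has nothing
      -- left to be joined to, so any edge can be named as `e₀`.
      (core (not ∘ U) (≺-wellFounded _) (λ _ p → p) x (≡.cong not Ux)
        (e₀ , λ _ _ _ Rb Xb → contradiction Rb (false≢true Xb)))
      (λ smaller′ → solve e₀ (smaller smaller′))

    three-flows : Edge → ∃[ h ] ∃[ p ] ∃[ q ] IsFlow h × IsFlow p × IsFlow q ×
                  (∀ e → Γ e ≡ true → h e ≡ true ⊎ p e ≡ true ⊎ q e ≡ true)
    three-flows e₀ = h , p , q , h-flow , p-flow , q-flow , covered
      where
      U : VertexSet
      -- Exactly the representatives, one vertex for each component of `Γ`, so that no edges are
      -- needed to connect them.
      U v = does (v ≟ rep v)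

      initial : State U (λ _ → false)
      initial = record
        { W⊆Γ = λ _ ()
        ; W-inside = λ ()
        ; to-rep = λ {u} Uu → ≡.subst (u ~[ _ ]_) (witness (u ≟ rep u) Uu) ~-refl
        ; rep∈U = λ v → dec-true (rep v ≟ rep (rep v)) (representative-cong (~-representative v))
        }

      open Covering (solve e₀ (≺-wellFounded _) initial)

      covered : ∀ e → Γ e ≡ true → h e ≡ true ⊎ p e ≡ true ⊎ q e ≡ true
      covered e Γe with h e in he
      ... | true  = inj₁ ≡.refl
      ... | false = inj₂ (∨⁻ (covers e Γe he ≡.refl))

-- Components and bridges

module CountClasses {n k l : ℕ}
  {to : Fin n → Fin k} {from : Fin k → Fin n} (to∘from : ∀ i → to (from i) ≡ i)
  {to′ : Fin n → Fin l} {from′ : Fin l → Fin n} (to′∘from′ : ∀ i → to′ (from′ i) ≡ i)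
  (refines : ∀ {x y} → to x ≡ to y → to′ x ≡ to′ y)
  where

  same : (∀ {x y} → to′ x ≡ to′ y → to x ≡ to y) → k ≡ l
  same coarsens = ↔⇒≡ (mk↔ₛ′ (to′ ∘ from) (to ∘ from′)
    (λ i → ≡.trans (refines (to∘from _)) (to′∘from′ i))
    (λ i → ≡.trans (coarsens (to′∘from′ _)) (to∘from i)))

  -- The class of `v` is matched with the additional element `zero`, every other class with the
  -- merged class that contains it. On the way back, the class merged from `u` and `v` yields the
  -- class of `u`, whichever representative it has.
  one-more : ∀ {u v} → to u ≢ to v → to′ u ≡ to′ v →
             (∀ {x y} → to′ x ≡ to′ y → to x ≡ to y ⊎
                (to x ≡ to u × to y ≡ to v) ⊎ (to x ≡ to v × to y ≡ to u)) →
             k ≡ suc l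
  one-more {u} {v} u≢v u≡′v merges = ↔⇒≡ (mk↔ₛ′ f g f∘g g∘f)
    where
    f : Fin k → Fin (suc l)
    f i = if does (i ≟ to v) then zero else suc (to′ (from i))

    g : Fin (suc l) → Fin k
    g zero    = to v
    g (suc j) = if does (to (from′ j) ≟ to v) then to u else to (from′ j)

    f-off : ∀ {x} → to x ≢ to v → f (to x) ≡ suc (to′ x)
    f-off {x} x≢v rewrite dec-false (to x ≟ to v) x≢v = ≡.cong suc (refines (to∘from _))

    f∘g : ∀ j → f (g j) ≡ j
    f∘g zero rewrite dec-true (to v ≟ to v) ≡.refl = ≡.refl
    f∘g (suc j) with to (from′ j) ≟ to v
    ... | yes p = ≡.trans (f-off u≢v)
                    (≡.cong suc (≡.trans u≡′v (≡.trans (refines (≡.sym p)) (to′∘from′ j))))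
    ... | no ¬p = ≡.trans (f-off ¬p) (≡.cong suc (to′∘from′ j))

    g∘f : ∀ i → g (f i) ≡ i
    g∘f i with i ≟ to v
    ... | yes p = ≡.sym p
    ... | no ¬p with to (from′ (to′ (from i))) ≟ to v | merges (to′∘from′ (to′ (from i)))
    ...   | yes q | inj₁ r              = contradiction (≡.trans (≡.sym (to∘from i)) (≡.trans (≡.sym r) q)) ¬p
    ...   | _     | inj₂ (inj₁ (_ , r)) = contradiction (≡.trans (≡.sym (to∘from i)) r) ¬p
    ...   | yes q | inj₂ (inj₂ (_ , r)) = ≡.trans (≡.sym r) (to∘from i)
    ...   | no ¬q | inj₁ r              = ≡.trans r (to∘from i)
    ...   | no ¬q | inj₂ (inj₂ (r , _)) = contradiction r ¬q

all : ∀ {m} → Fin m → Bool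
all _ = true

lookup-injective : ∀ {a} {A : Set a} {xs : List A} → Unique xs →
                   ∀ i j → lookup xs i ≡ lookup xs j → i ≡ j
lookup-injective (_ ∷ _)   zero    zero    _  = ≡.refl
lookup-injective (x∉ ∷ _)  zero    (suc j) eq = contradiction eq (All.lookup x∉ (∈-lookup j))
lookup-injective (x∉ ∷ _)  (suc i) zero    eq = contradiction (≡.sym eq) (All.lookup x∉ (∈-lookup i))
lookup-injective (_ ∷ xs!) (suc i) (suc j) eq = ≡.cong suc (lookup-injective xs! i j eq)

module Components (H : Graph) where
  open Graph H
  open Walks H

  private module I = Inverse (proj₂ (components ends))

  ≡⇒~ : ∀ {u v} → componentOf H u ≡ componentOf H v → u ~[ all ] v
  ≡⇒~ {u} {v} p = EqC.fold isEquivalence (λ { (e , ≡.refl) → ~-edge ≡.refl (fwd {e = e}) })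
    (EqC.transitive _ (EqC.symmetric _ (I.inverseʳ ≡.refl)) (I.inverseʳ p))
    where
    isEquivalence : IsEquivalence (_~[ all ]_)
    isEquivalence = record { refl = ~-refl ; sym = ~-sym ; trans = ~-trans }

  ~⇒≡ : ∀ {u v} → u ~[ all ] v → componentOf H u ≡ componentOf H v
  ~⇒≡ {u} u~v = ~-induction (λ v → componentOf H u ≡ componentOf H v) step u~v ≡.refl
    where
    step : ∀ e {v w} → all e ≡ true → Joins e v w →
           componentOf H u ≡ componentOf H v → componentOf H u ≡ componentOf H w
    step e _ fwd p = ≡.trans p (componentOf-ends H e)
    step e _ bwd p = ≡.trans p (≡.sym (componentOf-ends H e))

  -- A 2-colouring of one component, written on the vertices of `H` to avoid the renumbering done by
  -- `component`.
  ProperOn : Fin (#components H) → (Vertex → Bool) → Set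
  ProperOn i side = ∀ e → componentOf H (proj₁ (ends e)) ≡ i →
                    side (proj₁ (ends e)) ≢ side (proj₂ (ends e))

  module _ (i : Fin (#components H)) where
    private
      module C = Graph (component H i)

      inVertices? : ∀ v → Dec (componentOf H v ≡ i)
      inVertices? v = componentOf H v ≟ i

      inEdges? : ∀ e → Dec (componentOf H (proj₁ (ends e)) ≡ i)
      inEdges? e = componentOf H (proj₁ (ends e)) ≟ i

      -- The lists and membership proofs repeat the local ones of `component`, so that both agree by
      -- computation.
      vs : List Vertex
      vs = filter inVertices? (allFin order)

      es : List Edge
      es = filter inEdges? (allFin size)

      es-inside : ∀ k → componentOf H (proj₁ (ends (lookup es k))) ≡ i
      es-inside k = proj₂ (∈-filter⁻ inEdges? {xs = allFin size} (∈-lookup k))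

      first : ∀ k → lookup vs (proj₁ (C.ends k)) ≡ proj₁ (ends (lookup es k))
      first k = ≡.sym (lookup-index (∈-filter⁺ inVertices? (∈-allFin _) (es-inside k)))

      second : ∀ k → lookup vs (proj₂ (C.ends k)) ≡ proj₂ (ends (lookup es k))
      second k = ≡.sym (lookup-index (∈-filter⁺ inVertices? (∈-allFin _)
        (≡.trans (≡.sym (componentOf-ends H (lookup es k))) (es-inside k))))

    proper⇒bipartite : ∀ {side} → ProperOn i side → Bipartite (component H i)
    proper⇒bipartite {side} proper = side ∘ lookup vs , λ k eq →
      proper (lookup es k) (es-inside k)
        (≡.trans (≡.sym (≡.cong side (first k))) (≡.trans eq (≡.cong side (second k))))

    bipartite⇒proper : Bipartite (component H i) → ∃[ side ] ProperOn i side
    bipartite⇒proper (side , proper) = side′ , proper′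
      where
      side′ : Vertex → Bool
      side′ v with inVertices? v
      ... | yes p = side (index (∈-filter⁺ inVertices? (∈-allFin v) p))
      ... | no _  = true

      vs-unique : Unique vs
      vs-unique = Unique.filter⁺ inVertices? (Unique.allFin⁺ order)

      -- No vertex occurs twice in `vs`, so the index found for `v` can only be `k`.
      side′-lookup : ∀ {v} k → lookup vs k ≡ v → componentOf H v ≡ i → side′ v ≡ side k
      side′-lookup {v} k eq v∈i with inVertices? v
      ... | yes p = ≡.cong side (lookup-injective vs-unique _ _
                      (≡.trans (≡.sym (lookup-index (∈-filter⁺ inVertices? (∈-allFin v) p))) (≡.sym eq)))
      ... | no ¬p = contradiction v∈i ¬p

      proper′ : ProperOn i side′
      proper′ e e∈i eq = proper k (≡.trans (≡.sym (side′-lookup (proj₁ (C.ends k))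
          (≡.trans (first k) (≡.cong (proj₁ ∘ ends) k≡e)) e∈i))
          (≡.trans eq (side′-lookup (proj₂ (C.ends k))
            (≡.trans (second k) (≡.cong (proj₂ ∘ ends) k≡e))
            (≡.trans (≡.sym (componentOf-ends H e)) e∈i))))
        where
        e∈es = ∈-filter⁺ inEdges? (∈-allFin e) e∈i
        k = index e∈es

        k≡e : lookup es k ≡ e
        k≡e = ≡.sym (lookup-index e∈es)

-- A graph without edges is properly coloured by any map, which reduces the case of `K₁` to the
-- bipartite one.
≅K₁⇒bipartite : ∀ {H} → H ≅ K₁ → Bipartite H
≅K₁⇒bipartite H≅K₁ = (λ _ → true) , λ e _ → ¬Fin0 (Inverse.to (_≅_.edges H≅K₁) e)
  where
  ¬Fin0 : ¬ Fin 0
  ¬Fin0 ()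

-- The number of edges is exposed as a successor, the form in which `-ₑ` computes.
module Bridges {n m : ℕ} (ends : Fin (suc m) → Fin n × Fin n)
  (loopless : ∀ e → proj₁ (ends e) ≢ proj₂ (ends e)) where

  G : Graph
  G = record { order = n ; size = suc m ; ends = ends ; loopless = loopless }

  open Graph G using (Vertex; Edge)
  open EdgeSets G

  module _ (b : Edge) where
    private
      module W = Walks (G -ₑ b)
      module C = Components (G -ₑ b)
      module I = Inverse (proj₂ (components (Graph.ends (G -ₑ b))))
      module J = Inverse (proj₂ (components ends))

    u v : Vertex
    u = proj₁ (ends b)
    v = proj₂ (ends b)

    lift : ∀ {e x y} → W.Joins e x y → Joins (punchIn b e) x y
    lift W.fwd = fwd
    lift W.bwd = bwd

    lower : ∀ {e x y} → Joins (punchIn b e) x y → W.Joins e x y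
    lower fwd = W.fwd
    lower bwd = W.bwd

    component≡⇒~ : ∀ {x y} → componentOf (G -ₑ b) x ≡ componentOf (G -ₑ b) y → x ~[ all ∖ b ] y
    component≡⇒~ {x} p = W.~-induction (x ~[ all ∖ b ]_)
      (λ e _ e-joins q → ~-trans q (~-edge (∖⁺ {all} ≡.refl (punchInᵢ≢i b e)) (lift e-joins)))
      (C.≡⇒~ p) ~-refl

    ~⇒component≡ : ∀ {x y} → x ~[ all ∖ b ] y → componentOf (G -ₑ b) x ≡ componentOf (G -ₑ b) y
    ~⇒component≡ {x} x~y = C.~⇒≡ (~-induction (x W.~[ all ]_) step x~y W.~-refl)
      where
      step : ∀ e {y z} → (all ∖ b) e ≡ true → Joins e y z → x W.~[ all ] y → x W.~[ all ] z
      step e e∈ e-joins p = W.~-trans p (W.~-edge ≡.refl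
        (lower (≡.subst (λ e → Joins e _ _) (≡.sym (punchIn-punchOut b≢e)) e-joins)))
        where
        b≢e : b ≢ e
        b≢e = ≡.≢-sym (proj₂ (∖⁻ {all} e∈))

    private
      refines : ∀ {x y} → componentOf (G -ₑ b) x ≡ componentOf (G -ₑ b) y → componentOf G x ≡ componentOf G y
      refines p = Components.~⇒≡ G (~-mono (λ _ _ → ≡.refl) (component≡⇒~ p))

      open CountClasses {to = I.to} {from = I.from} I.strictlyInverseˡ
                        {to′ = J.to} {from′ = J.from} J.strictlyInverseˡ refines

    -- If the ends of `b` stayed connected without it, a walk over `b` could be rerouted, and
    -- deleting `b` would not change the number of components.
    bridge⇒separated : IsBridge G b → ¬ u ~[ all ∖ b ] v
    bridge⇒separated is-bridge u~v = ℕ.1+n≢n (≡.trans (≡.sym is-bridge) (same coarsens))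
      where
      step : ∀ {x} e {y z} → all e ≡ true → Joins e y z → x ~[ all ∖ b ] y → x ~[ all ∖ b ] z
      step e _ e-joins x~y with e ≟ b
      ... | no e≢b = ~-trans x~y (~-edge (∖⁺ {all} ≡.refl e≢b) e-joins)
      step e _ fwd x~y | yes ≡.refl = ~-trans x~y u~v
      step e _ bwd x~y | yes ≡.refl = ~-trans x~y (~-sym u~v)

      coarsens : ∀ {x y} → componentOf G x ≡ componentOf G y → componentOf (G -ₑ b) x ≡ componentOf (G -ₑ b) y
      coarsens {x} p = ~⇒component≡ (~-induction (x ~[ all ∖ b ]_) step (Components.≡⇒~ G p) ~-refl)

    -- Restoring `b` merges the classes of its two ends and no others, so deleting it creates
    -- exactly one more class.
    separated⇒bridge : ¬ u ~[ all ∖ b ] v → IsBridge G b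
    separated⇒bridge u≁v = one-more {u} {v} (λ p → u≁v (component≡⇒~ p)) (componentOf-ends G b)
      (λ {x} {y} p → convert (~-induction (Merged x) step (Components.≡⇒~ G p) (inj₁ ~-refl)))
      where
      Merged : Vertex → Vertex → Set
      Merged x y = x ~[ all ∖ b ] y ⊎ (x ~[ all ∖ b ] u × y ~[ all ∖ b ] v) ⊎
                   (x ~[ all ∖ b ] v × y ~[ all ∖ b ] u)

      step : ∀ {x} e {y z} → all e ≡ true → Joins e y z → Merged x y → Merged x z
      step e _ e-joins q with e ≟ b
      step e _ e-joins q | no e≢b with y~z ← ~-edge (∖⁺ {all} ≡.refl e≢b) e-joins with q
      ... | inj₁ x~y                = inj₁ (~-trans x~y y~z)
      ... | inj₂ (inj₁ (x~u , y~v)) = inj₂ (inj₁ (x~u , ~-trans (~-sym y~z) y~v))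
      ... | inj₂ (inj₂ (x~v , y~u)) = inj₂ (inj₂ (x~v , ~-trans (~-sym y~z) y~u))
      step e _ fwd (inj₁ x~u)                | yes ≡.refl = inj₂ (inj₁ (x~u , ~-refl))
      step e _ bwd (inj₁ x~v)                | yes ≡.refl = inj₂ (inj₂ (x~v , ~-refl))
      step e _ fwd (inj₂ (inj₁ (x~u , u~v))) | yes ≡.refl = contradiction u~v u≁v
      step e _ bwd (inj₂ (inj₁ (x~u , _)))   | yes ≡.refl = inj₁ x~u
      step e _ fwd (inj₂ (inj₂ (x~v , _)))   | yes ≡.refl = inj₁ x~v
      step e _ bwd (inj₂ (inj₂ (x~v , v~u))) | yes ≡.refl = contradiction (~-sym v~u) u≁v

      convert : ∀ {x y} → Merged x y → let c = componentOf (G -ₑ b) in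
                c x ≡ c y ⊎ (c x ≡ c u × c y ≡ c v) ⊎ (c x ≡ c v × c y ≡ c u)
      convert (inj₁ p)              = inj₁ (~⇒component≡ p)
      convert (inj₂ (inj₁ (p , q))) = inj₂ (inj₁ (~⇒component≡ p , ~⇒component≡ q))
      convert (inj₂ (inj₂ (p , q))) = inj₂ (inj₂ (~⇒component≡ p , ~⇒component≡ q))

  nonBridges : EdgeSet
  nonBridges e = not (does (isBridge? G e))

  -- The ends of a non-bridge are still joined when it is deleted, and the edge closes such a join
  -- to an even set.
  flow-through : ∀ e → nonBridges e ≡ true → ∃[ C ] IsFlow C × C e ≡ true
  flow-through e p with proj₁ (ends e) ~[ all ∖ e ]? proj₂ (ends e)
  ... | no separated = contradiction (separated⇒bridge e separated) (refute (isBridge? G e) (not⁻ p))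
  ... | yes u~v with Q , Q⊆ , ∂Q ← walk⇒join (~-sym u~v) =
    single e true ⊕ Q ,
    closed⇒flow {single e true ⊕ Q} (Bounds-trans {single e true} {Q} (Bounds-single {e} fwd) ∂Q) ,
    ≡.cong₂ _xor_ (single-self e) (≢true⇒≡false {Q e} (λ Qe → proj₂ (∖⁻ {all} {e} {e} (Q⊆ e Qe)) ≡.refl))

  -- A bridge is the only edge across the cut given by one of its sides, and an even set cannot
  -- cross a cut only once.
  flow⊆nonBridges : ∀ {C} → IsFlow C → C ⊆ nonBridges
  flow⊆nonBridges {C} C-flow e Ce = ≡.cong not (dec-false (isBridge? G e) not-bridge)
    where
    not-bridge : ¬ IsBridge G e
    not-bridge is-bridge with e′ , _ , _ , e′≢e , _ , e′-joins , Xa , Xb ←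
      crossing-again {C} C-flow (class (all ∖ e) (proj₁ (ends e))) Ce fwd (class-self {all ∖ e} _)
        (≢true⇒≡false (λ p → bridge⇒separated e is-bridge (class⇒~ p))) =
      contradiction (class-closed {all ∖ e} (∖⁺ {all} ≡.refl e′≢e) e′-joins Xa) (false≢true Xb)

  three-flows : Edge → ∃[ h ] ∃[ p ] ∃[ q ] IsFlow h × IsFlow p × IsFlow q ×
                (∀ e → nonBridges e ≡ true → h e ≡ true ⊎ p e ≡ true ⊎ q e ≡ true)
  three-flows = Cover.Bridgeless.three-flows G nonBridges flow-through flow⊆nonBridges

  connected⇒~ : Connected G → ∀ x y → x ~[ all ] y
  connected⇒~ conn x y = Components.≡⇒~ G (Fin1 conn _ _)
    where
    Fin1 : ∀ {k} → k ≡ 1 → (i j : Fin k) → i ≡ j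
    Fin1 ≡.refl zero zero = ≡.refl

  -- A bipartite side of a bridge excludes magic labellings

  module NotMagic (conn : Connected G) {b : Edge} (is-bridge : IsBridge G b)
    (i : Fin (#components (G -ₑ b))) {side : Vertex → Bool}
    (proper : Components.ProperOn (G -ₑ b) i side)
    {c ℓ} (A : AbelianGroup c ℓ) where
    open AbelianGroup A
    open Signs A
    open Sum commutativeMonoid
    open SumProperties commutativeMonoid
    module ChA = Chains A G

    in-i? : ∀ x → Dec (componentOf (G -ₑ b) x ≡ i)
    in-i? x = componentOf (G -ₑ b) x ≟ i

    -- The signed indicator of the component `i`: signs follow the two sides, so every edge other
    -- than `b` contributes zero to the weighted sum of boundaries.
    weight : Vertex → Carrier → Carrier
    weight x a with in-i? x
    ... | yes _ = sign (side x) a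
    ... | no _  = ε

    weight-ε : ∀ x → weight x ε ≈ ε
    weight-ε x with in-i? x
    ... | yes _ = sign-ε (side x)
    ... | no _  = refl

    weight-∙ : ∀ x a a′ → weight x (a ∙ a′) ≈ weight x a ∙ weight x a′
    weight-∙ x a a′ with in-i? x
    ... | yes _ = sign-∙ (side x) a a′
    ... | no _  = sym (identityˡ ε)

    weight-cong : ∀ x {a a′} → a ≈ a′ → weight x a ≈ weight x a′
    weight-cong x p with in-i? x
    ... | yes _ = sign-cong (side x) p
    ... | no _  = refl

    other-edge : ∀ (φ : Edge → Carrier) e → e ≢ b →
                 weight (proj₁ (ends e)) (φ e) ∙ weight (proj₂ (ends e)) (φ e) ≈ ε
    other-edge φ e e≢b = ≡.subst (λ e → weight (proj₁ (ends e)) (φ e) ∙ weight (proj₂ (ends e)) (φ e) ≈ ε)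
      (punchIn-punchOut (≡.≢-sym e≢b)) (lifted (punchOut (≡.≢-sym e≢b)))
      where
      lifted : ∀ e′ → let e = punchIn b e′ in
               weight (proj₁ (ends e)) (φ e) ∙ weight (proj₂ (ends e)) (φ e) ≈ ε
      lifted e′ with in-i? (proj₁ (ends (punchIn b e′))) | in-i? (proj₂ (ends (punchIn b e′)))
      ... | yes p | yes _ = sign-opposite (proper e′ p) _
      ... | no _  | no _  = identityˡ ε
      ... | yes p | no ¬q = contradiction (≡.trans (≡.sym (componentOf-ends (G -ₑ b) e′)) p) ¬q
      ... | no ¬p | yes q = contradiction (≡.trans (componentOf-ends (G -ₑ b) e′) q) ¬p

    i-inhabited : ∃[ x ] componentOf (G -ₑ b) x ≡ i
    i-inhabited = _ , Inverse.strictlyInverseˡ (proj₂ (components (Graph.ends (G -ₑ b)))) i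

    -- Exactly one end of `b` lies in the component `i`. Both would contradict that `b` separates
    -- its ends; with neither, `i` would be closed under all edges of `G`, which is connected.
    bridge-weight : ∀ {a} → weight (proj₁ (ends b)) a ∙ weight (proj₂ (ends b)) a ≈ ε → a ≈ ε
    bridge-weight {a} eq with in-i? (proj₁ (ends b)) | in-i? (proj₂ (ends b))
    ... | yes p | yes q = contradiction (component≡⇒~ b (≡.trans p (≡.sym q))) (bridge⇒separated b is-bridge)
    ... | yes _ | no _  = sign-≈ε (side (proj₁ (ends b))) (trans (sym (identityʳ _)) eq)
    ... | no _  | yes _ = sign-≈ε (side (proj₂ (ends b))) (trans (sym (identityˡ _)) eq)
    ... | no ¬p | no ¬q = contradiction
      (~-induction (λ x → componentOf (G -ₑ b) x ≡ i) step
        (connected⇒~ conn (proj₁ i-inhabited) (proj₁ (ends b))) (proj₂ i-inhabited)) ¬p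
      where
      step : ∀ e {x y} → all e ≡ true → Joins e x y →
             componentOf (G -ₑ b) x ≡ i → componentOf (G -ₑ b) y ≡ i
      step e _ e-joins x∈i with e ≟ b
      step e _ e-joins x∈i | no e≢b =
        ≡.trans (~⇒component≡ b (~-edge (∖⁺ {all} ≡.refl e≢b) (Joins-sym e-joins))) x∈i
      step e _ fwd x∈i | yes ≡.refl = contradiction x∈i ¬p
      step e _ bwd x∈i | yes ≡.refl = contradiction x∈i ¬q

    not-magic : ¬ ZeroSumMagic A G
    not-magic (φ , φ≉ε , zero-sum) = φ≉ε b (bridge-weight (begin
      weight (proj₁ (ends b)) (φ b) ∙ weight (proj₂ (ends b)) (φ b)
        ≈⟨ sum-single _ b (other-edge φ) ⟨
      sum (λ e → weight (proj₁ (ends e)) (φ e) ∙ weight (proj₂ (ends e)) (φ e))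
        ≈⟨ ChA.handshake weight weight-ε weight-∙ φ ⟨
      sum (λ x → weight x (ChA.∂ φ x))
        ≈⟨ sum-ε _ (λ x → trans (weight-cong x (zero-sum x)) (weight-ε x)) ⟩
      ε ∎))
      where open ≈-Reasoning setoid

-- Odd closed walks

module OddWalks {c ℓ} (A : AbelianGroup c ℓ) (G : Graph) where
  open AbelianGroup A
  open Signs A
  open Graph G
  open Walks G
  open Chains A G
  open CommutativeMonoidSolver commutativeMonoid using (solve; _⊕_; _⊜_)
  open ≈-Reasoning setoid

  Supported : (Edge → Bool) → Chain → Set ℓ
  Supported D ψ = ∀ e → D e ≡ false → ψ e ≈ ε

  module _ (D : Edge → Bool) (x : Vertex) (a : Carrier) where
    private
      Reached : Vertex → Bool → Set _
      Reached v s = ∃[ ψ ] Supported D ψ × ∀ w → ∂ ψ w ≈ point x a w ∙ point v (sign s a) w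

      reach : ∀ v → ∃[ s ] (x ~[ D ] v → Reached v s)
      reach v with x ~[ D ]? v
      ... | yes p = proj₁ (walk⇒chain a p) , λ _ → proj₂ (walk⇒chain a p)
      -- A default side, so that `side` is total; only vertices reachable from `x` are ever
      -- compared.
      ... | no ¬p = true , λ p → contradiction p ¬p

      side : Vertex → Bool
      side v = proj₁ (reach v)

    -- The chain is 2a at x: it alternates along a walk of odd length that returns to x.
    odd-closed-walk :
      (∃[ side ] ∀ e {u v} → D e ≡ true → Joins e u v → x ~[ D ] u → side u ≢ side v) ⊎
      (∃[ ψ ] Supported D ψ × ∀ w → ∂ ψ w ≈ point x (a ∙ a) w)
    odd-closed-walk with any? (λ e → (D e Bool.≟ true) ×-dec (x ~[ D ]? proj₁ (ends e)) ×-dec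
                                     (side (proj₁ (ends e)) Bool.≟ side (proj₂ (ends e))))
    ... | no none = inj₁ (side , proper)
      where
      proper : ∀ e {u v} → D e ≡ true → Joins e u v → x ~[ D ] u → side u ≢ side v
      proper e De fwd x~u eq = none (e , De , x~u , eq)
      proper e De bwd x~u eq = none (e , De , ~-trans x~u (~-edge De (bwd {e = e})) , ≡.sym eq)
    ... | yes (e , De , x~u , eq)
      with ψ₁ , support₁ , ∂ψ₁ ← proj₂ (reach (proj₁ (ends e))) x~u
      with ψ₂ , support₂ , ∂ψ₂ ← proj₂ (reach (proj₂ (ends e))) (~-trans x~u (~-edge De (fwd {e = e})))
      = inj₂ (ψ , support , ∂ψ)
      where
      u = proj₁ (ends e)
      v = proj₂ (ends e)
      σa = sign (side u) a

      χ ψ : Chain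
      -- Two walks from `x` arrive at the ends of `e` with the same value `σa`. Putting its inverse
      -- on `e` cancels both ends at once and leaves `a` twice at `x`.
      χ e′ = ψ₂ e′ ∙ single e (σa ⁻¹) e′
      ψ e′ = ψ₁ e′ ∙ χ e′

      support : Supported D ψ
      support e′ De′ with e′ ≟ e
      ... | yes ≡.refl = contradiction De (false≢true De′)
      ... | no _ = trans (∙-cong (support₁ e′ De′) (∙-congʳ (support₂ e′ De′)))
                     (trans (identityˡ _) (identityˡ ε))

      ∂ψ : ∀ w → ∂ ψ w ≈ point x (a ∙ a) w
      ∂ψ w = begin
        ∂ ψ w                                   ≈⟨ trans (∂-∙ ψ₁ χ w) (∙-congˡ (∂-∙ ψ₂ (single e (σa ⁻¹)) w)) ⟩
        ∂ ψ₁ w ∙ (∂ ψ₂ w ∙ ∂ (single e (σa ⁻¹)) w)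
          ≈⟨ ∙-cong (∂ψ₁ w) (∙-cong ∂ψ₂′ (∂-single (σa ⁻¹) fwd w)) ⟩
        (X ∙ U) ∙ ((X ∙ V) ∙ (U⁻ ∙ V⁻))
          ≈⟨ solve 5 (λ x u v u⁻ v⁻ → (x ⊕ u) ⊕ ((x ⊕ v) ⊕ (u⁻ ⊕ v⁻)) ⊜ (x ⊕ x) ⊕ ((u ⊕ u⁻) ⊕ (v ⊕ v⁻)))
               refl X U V U⁻ V⁻ ⟩
        (X ∙ X) ∙ ((U ∙ U⁻) ∙ (V ∙ V⁻))
          ≈⟨ ∙-cong (sym (point-∙ x a a w)) (∙-cong (point-inverse u σa w) (point-inverse v σa w)) ⟩
        point x (a ∙ a) w ∙ (ε ∙ ε)             ≈⟨ trans (∙-congˡ (identityˡ ε)) (identityʳ _) ⟩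
        point x (a ∙ a) w                       ∎
        where
        X  = point x a w
        U  = point u σa w
        V  = point v σa w
        U⁻ = point u (σa ⁻¹) w
        V⁻ = point v (σa ⁻¹) w

        ∂ψ₂′ : ∂ ψ₂ w ≈ X ∙ V
        ∂ψ₂′ = ≡.subst (λ s → ∂ ψ₂ w ≈ X ∙ point v (sign s a) w) (≡.sym eq) (∂ψ₂ w)

  -- The edge `b` carries `a`, and subtracting the two chains removes its boundary at either end.
  -- They vanish on `b`, so its value stays `a`.
  cancel-ends : ∀ {D u v b} a → Joins b u v → D b ≡ false →
    (∃[ ψ ] Supported D ψ × ∀ w → ∂ ψ w ≈ point u a w) →
    (∃[ ψ ] Supported D ψ × ∀ w → ∂ ψ w ≈ point v a w) →
    ∃[ ψ ] (∀ w → ∂ ψ w ≈ ε) × ψ b ≈ a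
  cancel-ends {D} {u} {v} {b} a b-joins Db (ψ₁ , support₁ , ∂ψ₁) (ψ₂ , support₂ , ∂ψ₂) =
    ψ , ∂ψ , ψb
    where
    open AbelianGroupProperties A using (⁻¹-∙-comm; ε⁻¹≈ε)

    χ ψ : Chain
    χ e = ψ₁ e ∙ ψ₂ e
    ψ e = single b a e ∙ (χ e) ⁻¹

    χb : χ b ≈ ε
    χb = trans (∙-cong (support₁ b Db) (support₂ b Db)) (identityˡ ε)

    ψb : ψ b ≈ a
    ψb rewrite dec-true (b ≟ b) ≡.refl = trans (∙-congˡ (trans (⁻¹-cong χb) ε⁻¹≈ε)) (identityʳ a)

    ∂ψ : ∀ w → ∂ ψ w ≈ ε
    ∂ψ w = begin
      ∂ ψ w                                              ≈⟨ ∂-∙ (single b a) (λ e → (χ e) ⁻¹) w ⟩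
      ∂ (single b a) w ∙ ∂ (λ e → (χ e) ⁻¹) w
        ≈⟨ ∙-cong (∂-single a b-joins w)
             (sym (ChainHomomorphism.∂-homo A A G _⁻¹ ε⁻¹≈ε (λ x y → sym (⁻¹-∙-comm x y)) χ w)) ⟩
      (point u a w ∙ point v a w) ∙ (∂ χ w) ⁻¹
        ≈⟨ ∙-congˡ (⁻¹-cong (trans (∂-∙ ψ₁ ψ₂ w) (∙-cong (∂ψ₁ w) (∂ψ₂ w)))) ⟩
      (point u a w ∙ point v a w) ∙ (point u a w ∙ point v a w) ⁻¹ ≈⟨ inverseʳ _ ⟩
      ε                                                  ∎

-- Labellings over ℤ/2j

module Residues (n : ℕ) .{{_ : NonZero n}} where
  open AbelianGroup (ℤ/ n) using (_≈_; ε; trans; sym)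

  residue : ℤ → Fin n
  residue z = fromℕ< (ℤ.n%ℕd<d z n)

  residue-≈ : ∀ z → + toℕ (residue z) ≈ z
  residue-≈ z rewrite toℕ-fromℕ< (ℤ.n%ℕd<d z n) =
    sym {z} {+ (z ℤ.%ℕ n)} (≡.subst (+ n ℤ∣.∣_) (≡.sym difference) (ℤ∣.∣n⇒∣m*n (z ℤ./ℕ n) ℤ∣.∣-refl))
    where
    difference : z ℤ.- + (z ℤ.%ℕ n) ≡ (z ℤ./ℕ n) ℤ.* + n
    difference = ≡.trans (≡.cong (ℤ._- + (z ℤ.%ℕ n)) (ℤ.a≡a%ℕn+[a/ℕn]*n z n)) (cancel (+ (z ℤ.%ℕ n)) _)
      where
      cancel : ∀ r s → (r ℤ.+ s) ℤ.- r ≡ s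
      cancel = solve-∀

  ≉ε : ∀ {k} → 0 < k → k < n → ¬ + k ≈ ε
  ≉ε {suc k} _ k<n n∣k = ℕ∣.>⇒∤ k<n (≡.subst (n ℕ∣.∣_) (≡.cong suc (ℕ.+-identityʳ k)) (ℤ∣.∣⇒∣ᵤ n∣k))

  module _ (c : ℕ) where
    private module P = AbelianGroup (ℤ/ n ^ c)

    _≈?_ : ∀ f g → Dec (f P.≈ g)
    f ≈? g = all? (λ i → + n ℤ∣.∣? (f i ℤ.- g i))

    -- Only the residues of the labels matter, so finitely many labellings, coded as numbers below
    -- `(n ^ c) ^ size`, need to be searched. This is what makes a least exponent available.
    magic? : ∀ G → Dec (ZeroSumMagic (ℤ/ n ^ c) G)
    magic? G = map′ (λ { (t , t-magic) → decode t , t-magic }) encode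
      (any? λ t → all? (λ e → ¬? (decode t e ≈? P.ε)) ×-dec all? (λ v → ∂ (decode t) v ≈? P.ε))
      where
      open Graph G
      open Chains (ℤ/ n ^ c) G

      decode : Fin ((n ℕ.^ c) ℕ.^ size) → Chain
      decode t e i = + toℕ (finToFun (finToFun t e) i)

      encode : ZeroSumMagic (ℤ/ n ^ c) G →
               ∃[ t ] (∀ e → ¬ decode t e P.≈ P.ε) × (∀ v → ∂ (decode t) v P.≈ P.ε)
      encode (φ , φ≉ε , zero-sum) = t ,
        (λ e p → φ≉ε e (P.trans {φ e} {decode t e} {P.ε} (P.sym {decode t e} {φ e} (decode-t e)) p)) ,
        λ v → P.trans {∂ (decode t) v} {∂ φ v} {P.ε} (∂-cong decode-t v) (zero-sum v)
        where
        code : Edge → Fin (n ℕ.^ c)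
        code e = funToFin (residue ∘ φ e)

        t = funToFin code

        decode-t : ∀ e → decode t e P.≈ φ e
        decode-t e i rewrite finToFun-funToFin code e | finToFun-funToFin (residue ∘ φ e) i =
          residue-≈ (φ e i)

least : ∀ {p} {P : Pred ℕ p} → Decidable P → ∀ {c} → P c →
        ∃[ z ] P z × z ≤ c × (∀ c′ → P c′ → z ≤ c′)
least {P = P} P? {c} = <-rec (λ c → P c → ∃[ z ] P z × z ≤ c × (∀ c′ → P c′ → z ≤ c′)) step c
  where
  step : ∀ c → (∀ {c′} → c′ < c → P c′ → ∃[ z ] P z × z ≤ c′ × (∀ c″ → P c″ → z ≤ c″)) →
         P c → ∃[ z ] P z × z ≤ c × (∀ c′ → P c′ → z ≤ c′)
  step c rec Pc with ℕ.anyUpTo? P? c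
  ... | no none = c , Pc , ℕ.≤-refl , λ c′ Pc′ → ℕ.≮⇒≥ (λ c′<c → none (c′ , c′<c , Pc′))
  ... | yes (c′ , c′<c , Pc′) with z , Pz , z≤c′ , z-least ← rec c′<c Pc′ =
    z , Pz , ℕ.≤-trans z≤c′ (ℕ.<⇒≤ c′<c) , z-least

-- Numbers the members of `S` in order and stores the chosen witness of each at its number; this
-- gives every bridge a coordinate of its own.
enumerate : ∀ {m a p} {A : Set a} (S : Subset m) (P : Fin m → A → Set p) →
            (∀ {e} → e Subset.∈ S → ∃[ x ] P e x) →
            ∃[ g ] (∀ {e} → e Subset.∈ S → ∃[ i ] P e (g i))
enumerate {A = A} S P choose = go S P choose
  where
  go : ∀ {m} (S : Subset m) (P : Fin m → A → Set _) → (∀ {e} → e Subset.∈ S → ∃[ x ] P e x) →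
       Σ[ g ∈ (Fin ∣ S ∣ → A) ] (∀ {e} → e Subset.∈ S → ∃[ i ] P e (g i))
  go []            P choose = (λ ()) , λ ()
  go (outside ∷ S) P choose with g , hit ← go S (P ∘ suc) (choose ∘ there) =
    g , λ { (there e∈S) → hit e∈S }
  go (inside ∷ S)  P choose with g , hit ← go S (P ∘ suc) (choose ∘ there) =
    (λ { zero → proj₁ (choose here) ; (suc i) → g i }) ,
    λ { here → zero , proj₂ (choose here) ; (there e∈S) → suc (proj₁ (hit e∈S)) , proj₂ (hit e∈S) }

∈B⇒bridge : ∀ G {b} → b Subset.∈ B G → IsBridge G b
∈B⇒bridge G {b} b∈B = witness (isBridge? G b)
  (≡.trans (≡.sym (lookup∘tabulate (does ∘ isBridge? G) b)) ([]=⇒lookup b∈B))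

bridge⇒∈B : ∀ G {b} → IsBridge G b → b Subset.∈ B G
bridge⇒∈B G {b} is-bridge = lookup⇒[]= b _
  (≡.trans (lookup∘tabulate (does ∘ isBridge? G) b) (dec-true (isBridge? G b) is-bridge))

module Coordinates (n : ℕ) (G : Graph) where
  open Graph G
  open AbelianGroup (ℤ/ n) using (_≈_; sym; trans) renaming (refl to ≈-refl)
  open Chains (ℤ/ n) G

  Kernel : Set
  Kernel = ∃[ ψ ] ∀ v → ∂ ψ v ≈ 0ℤ

  assemble : ∀ {c} (g : Fin c → Kernel) → (∀ e → ∃[ i ] ¬ proj₁ (g i) e ≈ 0ℤ) →
             ZeroSumMagic (ℤ/ n ^ c) G
  assemble {c} g covered = φ , (λ e φe≈0 → proj₂ (covered e) (φe≈0 (proj₁ (covered e)))) , zero-sum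
    where
    module Cᶜ = Chains (ℤ/ n ^ c) G

    φ : Cᶜ.Chain
    φ e i = proj₁ (g i) e

    zero-sum : ∀ v i → Cᶜ.∂ φ v i ≈ 0ℤ
    zero-sum v i = trans {Cᶜ.∂ φ v i} {∂ (proj₁ (g i)) v} {0ℤ}
      (ChainHomomorphism.∂-homo (ℤ/ n ^ c) (ℤ/ n) G (λ f → f i)
        (≈-refl {0ℤ}) (λ x y → ≈-refl {x i ℤ.+ y i}) φ v)
      (proj₂ (g i) v)

module EvenModulus (j : ℕ) (2≤j : 2 ≤ j) where
  open AbelianGroup (ℤ/ (2 * j)) using (_≈_; sym; trans) renaming (refl to ≈-refl)

  0<j : 0 < j
  0<j = ℕ.<-≤-trans (s≤s z≤n) 2≤j

  j<2j : j < 2 * j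
  j<2j = ℕ.m<m+n j (ℕ.<-≤-trans 0<j (ℕ.m≤m+n j 0))

  instance
    2j≢0 : NonZero (2 * j)
    2j≢0 = ℕ.>-nonZero (ℕ.<-trans 0<j j<2j)

  open Residues (2 * j) public

  j≉0 : ¬ + j ≈ 0ℤ
  j≉0 = ≉ε 0<j j<2j

  2≉0 : ¬ + 2 ≈ 0ℤ
  2≉0 = ≉ε (s≤s z≤n) (ℕ.≤-<-trans 2≤j j<2j)

  -- The embedding of `𝔽₂` as the subgroup of order two in ℤ/2j; it is additive because twice `j`
  -- vanishes.
  ι : Bool → ℤ
  ι b = if b then + j else 0ℤ

  ι-xor : ∀ x y → ι (x xor y) ≈ ι x ℤ.+ ι y
  ι-xor false y     = ≡.subst (ι y ≈_) (≡.sym (ℤ.+-identityˡ (ι y))) (≈-refl {ι y})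
  ι-xor true  false = ≡.subst (+ j ≈_) (≡.sym (ℤ.+-identityʳ (+ j))) (≈-refl {+ j})
  ι-xor true  true  = ≡.subst (λ k → + (2 * j) ℤ∣.∣ 0ℤ ℤ.- + k) (≡.cong (j ℕ.+_) (ℕ.+-identityʳ j))
    (≡.subst (+ (2 * j) ℤ∣.∣_) (≡.sym (ℤ.+-identityˡ (ℤ.- + (2 * j)))) (ℤ∣.∣m⇒∣-m ℤ∣.∣-refl))

  module _ (G : Graph) where
    open Coordinates (2 * j) G
    open Chains (ℤ/ (2 * j)) G using (∂)

    fromFlow : ∀ {C} → EdgeSets.IsFlow G C → Kernel
    fromFlow {C} C-flow = ι ∘ C , λ v → trans {∂ (ι ∘ C) v} {ι (EdgeSets.∂ G C v)} {0ℤ}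
      (sym {ι (EdgeSets.∂ G C v)} {∂ (ι ∘ C) v}
        (ChainHomomorphism.∂-homo 𝔽₂ (ℤ/ (2 * j)) G ι (≈-refl {0ℤ}) ι-xor C v))
      (≡.subst (λ b → ι b ≈ 0ℤ) (≡.sym (C-flow v)) (≈-refl {0ℤ}))

    ι≉0 : ∀ {b} → b ≡ true → ¬ ι b ≈ 0ℤ
    ι≉0 ≡.refl = j≉0

    magic : (∃[ h ] ∃[ p ] ∃[ q ] EdgeSets.IsFlow G h × EdgeSets.IsFlow G p × EdgeSets.IsFlow G q ×
              (∀ e → not (does (isBridge? G e)) ≡ true → h e ≡ true ⊎ p e ≡ true ⊎ q e ≡ true)) →
            (∀ b → IsBridge G b → Σ[ k ∈ Kernel ] (¬ proj₁ k b ≈ 0ℤ)) →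
            ZeroSumMagic (ℤ/ (2 * j) ^ (3 + ∣ B G ∣)) G
    magic (h , p , q , h-flow , p-flow , q-flow , flows-cover) bridge-kernel
      with g , g-covers ← enumerate (B G) (λ b k → ¬ proj₁ k b ≈ 0ℤ)
                             (λ {b} b∈B → bridge-kernel b (∈B⇒bridge G b∈B))
      = assemble coordinate covered
      where
      coordinate : Fin (3 + ∣ B G ∣) → Kernel
      coordinate zero                = fromFlow h-flow
      coordinate (suc zero)          = fromFlow p-flow
      coordinate (suc (suc zero))    = fromFlow q-flow
      coordinate (suc (suc (suc i))) = g i

      covered : ∀ e → ∃[ i ] ¬ proj₁ (coordinate i) e ≈ 0ℤ
      covered e with isBridge? G e in eq
      ... | yes is-bridge with i , p ← g-covers (bridge⇒∈B G is-bridge) = suc (suc (suc i)) , p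
      ... | no ¬bridge with flows-cover e (≡.cong (not ∘ does) eq)
      ...   | inj₁ he        = zero , ι≉0 he
      ...   | inj₂ (inj₁ pe) = suc zero , ι≉0 pe
      ...   | inj₂ (inj₂ qe) = suc (suc zero) , ι≉0 qe

    ζ-bound : ∀ {c} → 1 ≤ c → ZeroSumMagic (ℤ/ (2 * j) ^ c) G →
              ∃[ z ] Isζ (2 * j) G z × z ≤⁺ [ c ]
    ζ-bound {c} 1≤c c-magic
      with z , (1≤z , z-magic) , z≤c , z-least ←
        least {P = λ c → 1 ≤ c × ZeroSumMagic (ℤ/ (2 * j) ^ c) G}
              (λ c → (1 ℕ.≤? c) ×-dec magic? c G) (1≤c , c-magic)
      = [ z ] , (1≤z , z-magic , λ c′ 1≤c′ c′-magic → z-least c′ (1≤c′ , c′-magic)) , ≤⁺[ z≤c ]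

module BridgeLabels {n m : ℕ} (ends : Fin (suc m) → Fin n × Fin n)
  (loopless : ∀ e → proj₁ (ends e) ≢ proj₂ (ends e)) {c ℓ} (A : AbelianGroup c ℓ) where
  open Bridges ends loopless using (G; component≡⇒~)
  open AbelianGroup A
  open EdgeSets G using (Joins; fwd; bwd; _∖_; ∖⁺)
  open Chains A G using (∂; point)
  open OddWalks A G

  -- Without an odd closed walk at `x`, the parities of walks from `x` would properly colour the
  -- component of `x` in `G -ₑ b`.
  odd-walk-at : ∀ a b x → (∀ i → ¬ Bipartite (component (G -ₑ b) i)) →
                ∃[ ψ ] Supported (all ∖ b) ψ × ∀ w → ∂ ψ w ≈ point x (a ∙ a) w
  odd-walk-at a b x nonbipartite with odd-closed-walk (all ∖ b) x a
  ... | inj₂ result = result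
  ... | inj₁ (side , proper) = contradiction
    (Components.proper⇒bipartite (G -ₑ b) (componentOf (G -ₑ b) x) {side} λ e e∈i →
      proper (punchIn b e) (∖⁺ {all} ≡.refl (punchInᵢ≢i b e)) fwd (component≡⇒~ b (≡.sym e∈i)))
    (nonbipartite _)

  bridge-label : ∀ a b → (∀ i → ¬ Bipartite (component (G -ₑ b) i)) →
                 ∃[ ψ ] (∀ w → ∂ ψ w ≈ ε) × ψ b ≈ a ∙ a
  bridge-label a b nonbipartite = cancel-ends {all ∖ b} (a ∙ a) (fwd {e = b}) ∖-self
    (odd-walk-at a b _ nonbipartite) (odd-walk-at a b _ nonbipartite)
    where
    ∖-self : (all ∖ b) b ≡ false
    ∖-self = ≡.cong not (dec-true (b ≟ b) ≡.refl)

-- Having an edge forces the size to be a successor, which brings the graph into the form expected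
-- by `Bridges`.
non-bridge-cover : ∀ G → Graph.Edge G →
  ∃[ h ] ∃[ p ] ∃[ q ] EdgeSets.IsFlow G h × EdgeSets.IsFlow G p × EdgeSets.IsFlow G q ×
    (∀ e → not (does (isBridge? G e)) ≡ true → h e ≡ true ⊎ p e ≡ true ⊎ q e ≡ true)
non-bridge-cover record { size = suc m ; ends = ends ; loopless = loopless } =
  Bridges.three-flows ends loopless

bridge-label : ∀ {c ℓ} (A : AbelianGroup c ℓ) (let open AbelianGroup A) G a b →
  (∀ i → ¬ Bipartite (component (G -ₑ b) i)) →
  ∃[ ψ ] (∀ w → Chains.∂ A G ψ w ≈ ε) × ψ b ≈ a ∙ a
bridge-label A record { size = suc m ; ends = ends ; loopless = loopless } =
  BridgeLabels.bridge-label ends loopless A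

bipartite⇒not-magic : ∀ {c ℓ} (A : AbelianGroup c ℓ) G → Connected G → ∀ {b} → IsBridge G b →
  ∀ i → Bipartite (component (G -ₑ b) i) → ¬ ZeroSumMagic A G
bipartite⇒not-magic A G@record { size = suc m ; ends = ends ; loopless = loopless }
  connected {b} is-bridge i bipartite
  with side , proper ← Components.bipartite⇒proper (G -ₑ b) i bipartite =
  Bridges.NotMagic.not-magic ends loopless connected is-bridge i {side} proper A

theorem3p1 : ∀ {c ℓ} (j : ℕ) → 2 ≤ j → (G : Graph) → Connected G → Nonempty (B G) →
    (¬ (∃[ b ] b ∈ B G × ∃[ i ] (Bipartite (component (G -ₑ b) i) ⊎ component (G -ₑ b) i ≅ K₁)) →
    ∃[ z ] Isζ (2 * j) G z × z ≤⁺ [ 3 + ∣ B G ∣ ]) ×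
    ((∃[ b ] b ∈ B G × ∃[ i ] (Bipartite (component (G -ₑ b) i) ⊎ component (G -ₑ b) i ≅ K₁)) →
    (A : AbelianGroup c ℓ) → Finite A → NonTrivial A → ¬ ZeroSumMagic A G)
theorem3p1 j 2≤j G connected (b₀ , _) =
  (λ none → ζ-bound G (s≤s z≤n) (magic G (non-bridge-cover G b₀) λ b is-bridge →
    bridge-kernel b λ i bipartite → none (b , bridge⇒∈B G is-bridge , i , inj₁ bipartite))) ,
  λ { (b , b∈B , i , inj₁ bipartite) A _ _ → bipartite⇒not-magic A G connected (∈B⇒bridge G b∈B) i bipartite
    ; (b , b∈B , i , inj₂ ≅K₁)       A _ _ →
        bipartite⇒not-magic A G connected (∈B⇒bridge G b∈B) i (≅K₁⇒bipartite ≅K₁) }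
  where
  open EvenModulus j 2≤j
  open Coordinates (2 * j) G using (Kernel)
  open AbelianGroup (ℤ/ (2 * j)) using (_≈_; sym; trans)

  bridge-kernel : ∀ b → (∀ i → ¬ Bipartite (component (G -ₑ b) i)) → Σ[ k ∈ Kernel ] (¬ proj₁ k b ≈ 0ℤ)
  -- With 1 as the alternating value the bridge receives 1 + 1, which is non-zero modulo `2 * j`
  -- because `2 ≤ j`.
  bridge-kernel b nonbipartite with ψ , ∂ψ , ψb ← bridge-label (ℤ/ (2 * j)) G (+ 1) b nonbipartite =
    (ψ , ∂ψ) , λ ψb≈0 → 2≉0 (trans {+ 2} {ψ b} {0ℤ} (sym {ψ b} {+ 2} ψb) ψb≈0)
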